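{- Let $p$ be a prime and $\frac{a}{p}$ an irreducible fraction. If $\mathcal{S}_{\frac{a}{p}}(q)$ is reducible in $\mathbb Q[q]$, then every irreducible factor of $\mathcal{S}_{\frac{a}{p}}(q)$ in $\mathbb Q[q]$ has degree at least $7$.
   Context: For an integer $c$, $[c]_q=\frac{1-q^c}{1-q}$. Every rational $\alpha>1$ has a unique negative continued fraction expansion $\alpha=c_1-\cfrac{1}{c_2-\cfrac{1}{\ddots-\cfrac{1}{c_l}}}$ with integers $c_j\ge 2$. Put $M^-_q(c)=\begin{pmatrix}[c]_q & -q^{c-1}\\ 1 & 0\end{pmatrix}$ and define $\mathcal{R}_\alpha(q),\mathcal{S}_\alpha(q)$ by $\begin{pmatrix}\mathcal{R}_\alpha(q)\\ \mathcal{S}_\alpha(q)\end{pmatrix}=M^-_q(c_1)\cdots M^-_q(c_l)\begin{pmatrix}1\\0\end{pmatrix}$. For rational $\alpha\le 1$ they are defined recursively by $\mathcal{S}_\alpha(q)=\mathcal{S}_{\alpha+1}(q)$ and $\mathcal{R}_\alpha(q)=q^{ -1}(\mathcal{R}_{\alpha+1}(q)-\mathcal{S}_{\alpha+1}(q))$. $\mathcal{S}_\alpha(q)\in\mathbb Z[q]$. -}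

module Defs where

open import Data.Nat as ℕ using (ℕ; zero; suc; _∸_)
open import Data.Nat.DivMod using (_/_; _%_)
open import Data.Integer as ℤ using (ℤ; ∣_∣)
open import Data.Rational as ℚ using (ℚ; 0ℚ; 1ℚ)
open import Data.List using (List; []; _∷_; replicate; _++_; map)
open import Data.Product using (_×_; _,_; proj₁; proj₂; Σ; ∃)
open import Relation.Binary.PropositionalEquality using (_≡_; _≢_)
open import Relation.Nullary using (¬_; yes; no)
open import Relation.Nullary.Decidable using (⌊_⌋)
open import Data.Bool using (if_then_else_)
open import Data.Sum using (_⊎_)

-- Polynomials in ℚ[q]: coefficient lists, lowest degree first.
-- Trailing zeros are allowed; equality is coefficientwise (_≈P_).

Poly : Set
Poly = List ℚ

coeff : Poly → ℕ → ℚ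
coeff []       _       = 0ℚ
coeff (a ∷ f)  zero    = a
coeff (a ∷ f)  (suc n) = coeff f n

_≈P_ : Poly → Poly → Set
f ≈P g = ∀ n → coeff f n ≡ coeff g n

infix 4 _≈P_ _∣P_
infixl 6 _+P_ _-P_
infixl 7 _*P_ _·P_

_+P_ : Poly → Poly → Poly
[]      +P g       = g
f       +P []      = f
(a ∷ f) +P (b ∷ g) = (a ℚ.+ b) ∷ (f +P g)

_·P_ : ℚ → Poly → Poly
c ·P f = map (c ℚ.*_) f

negP : Poly → Poly
negP f = map ℚ.-_ f

_-P_ : Poly → Poly → Poly
f -P g = f +P negP g

_*P_ : Poly → Poly → Poly
[]      *P g = []
(a ∷ f) *P g = (a ·P g) +P (0ℚ ∷ (f *P g))

oneP : Poly
oneP = 1ℚ ∷ []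

shiftP : ℕ → Poly → Poly
shiftP k f = replicate k 0ℚ ++ f

HasDegree : Poly → ℕ → Set
HasDegree f d = coeff f d ≢ 0ℚ × (∀ n → d ℕ.< n → coeff f n ≡ 0ℚ)

IsZeroP : Poly → Set
IsZeroP f = f ≈P []

IsUnitP : Poly → Set
IsUnitP f = ∃ λ g → f *P g ≈P oneP

_∣P_ : Poly → Poly → Set
g ∣P f = ∃ λ h → f ≈P g *P h

IrreducibleP : Poly → Set
IrreducibleP f =
  ¬ IsZeroP f × ¬ IsUnitP f ×
  (∀ g h → f ≈P g *P h → IsUnitP g ⊎ IsUnitP h)

ReducibleP : Poly → Set
ReducibleP f = ¬ IsZeroP f × ¬ IsUnitP f × ¬ IrreducibleP f

qInt : ℕ → Poly
qInt c = replicate c 1ℚ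

-- (R_α, S_α) for α = n / d > 1, computed from the negative continued
-- fraction: α = c₁ - 1/α' with c₁ = ⌈α⌉, α' = d / (c₁ d - n), and
-- (R_α, S_α) = M⁻_q(c₁) (R_α', S_α') = ([c₁] R_α' - q^(c₁-1) S_α', R_α');
-- if α = c₁ is an integer, (R_α, S_α) = ([c₁], 1).
-- The fuel argument bounds the length of the expansion (the denominator
-- strictly decreases, so fuel = d suffices).
RSgt1 : ℕ → ℕ → ℕ → Poly × Poly
RSgt1 zero     n d       = [] , []
RSgt1 (suc f)  n zero    = [] , []
RSgt1 (suc f)  n (suc d) with n % suc d ℕ.≟ 0
... | yes _ = qInt (n / suc d) , oneP
... | no  _ =
  let c  = suc (n / suc d)
      r  = n % suc d
      RS = RSgt1 f (suc d) (suc d ∸ r)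
  in (qInt c *P proj₁ RS) -P shiftP (c ∸ 1) (proj₂ RS) , proj₁ RS

-- S_α for α = a / p, p > 0.  For α > 1 use the expansion; for α ≤ 1 use
-- S_α = S_{α+1} (fuel ∣a∣ + 2 suffices to reach α + k > 1).
Saux : ℕ → ℤ → ℕ → Poly
Saux zero    a p = []
Saux (suc k) a p =
  if ⌊ ℤ.+ p ℤ.<? a ⌋
  then proj₂ (RSgt1 p ∣ a ∣ p)
  else Saux k (a ℤ.+ ℤ.+ p) p

Sq : ℤ → ℕ → Poly
Sq a p = Saux (suc (suc ∣ a ∣)) a p

-- Write S = S_{a/p}. It is the first entry R of the pair attached to some p / s
-- with 0 < s < p, so S(1) = p, S(0) = 1, S is monic and has nonnegative
-- coefficients. At θ = -1, i, ω the matrices M⁻_q(c) preserve a definite Hermitian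
-- form, which bounds |S(θ)|, and a congruence modulo 1 - θ then makes S(θ) a unit
-- (for p ≥ 5; the cases p = 2, 3 are immediate).
--
-- Let f be a factor of degree at most 6. By Gauss's lemma f is integral with
-- f(0) = 1 after scaling. Its coefficient of q⁶ is 0 or ±1, its values
-- at -1, i, ω are units, and 0, ∞, -1, ±i, ω, ω² are seven interpolation nodes: f
-- is one of 144 explicit polynomials. As S is positive on [0, ∞), f(1) and f(2) are positive,
-- and f(1) divides p. Among the 96 remaining candidates only f = 1 has f(1) = 1,
-- while f(1) = p forces p ≤ 41, and for these p evaluation at 3 shows that f does
-- not divide S unless f = S.
module Submission where

open import Algebra.Bundles using (CommutativeRing)
open import Algebra.Structures using (IsCommutativeRing)
open import Data.Empty using (⊥; ⊥-elim)
open import Data.Integer as ℤ using (ℤ; +_; -[1+_]; 0ℤ; 1ℤ)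
import Data.Integer.Divisibility as ℤᵤ
open import Data.Integer.Divisibility.Signed as ℤ∣ using (_∣_; divides)
import Data.Integer.Properties as ℤP
open import Data.Integer.Tactic.RingSolver using (solve-∀)
open import Data.List using (List; []; _∷_; map; upTo)
open import Data.List.Membership.Propositional using (_∈_)
open import Data.List.Membership.Propositional.Properties using (∈-upTo⁺)
open import Data.List.Relation.Unary.All as All using (All; all?)
open import Data.List.Relation.Unary.Any using (here; there)
open import Data.Nat as ℕ using (ℕ; zero; suc; _∸_)
open import Data.Nat.Coprimality using (Coprime)
import Data.Nat.Divisibility as ℕ∣
open import Data.Nat.DivMod using (_/_; _%_; m%n<n; m≡m%n+[m/n]*n; m*n/n≡m)
open import Data.Nat.ListAction using (product)
open import Data.Nat.Primality
  using (Prime; prime?; euclidsLemma; prime⇒irreducible; prime⇒nonZero; ¬prime[0]; ¬prime[1])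
open import Data.Nat.Primality.Factorisation using (factorise; PrimeFactorisation)
import Data.Nat.Properties as ℕP
open import Data.Product using (_×_; _,_; proj₁; proj₂; ∃)
open import Data.Rational as ℚ using (ℚ; mkℚ; 0ℚ; 1ℚ; 1/_; *<*; *≤*)
open import Data.Rational.Literals using (fromℤ)
import Data.Rational.Properties as ℚP
open import Data.Rational.Solver using (module +-*-Solver)
import Data.Rational.Unnormalised as ℚᵘ
import Data.Rational.Unnormalised.Properties as ℚᵘP
open import Data.Sum using (_⊎_; inj₁; inj₂; [_,_]′)
open import Defs
open import Function using (id)
open import Level using (0ℓ)
open import Relation.Binary.Definitions using (DecidableEquality)
open import Relation.Binary.PropositionalEquality
open import Relation.Nullary using (Dec; yes; no; ¬_; ¬?; contradiction)
open import Relation.Nullary.Decidable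
  using (map′; _×-dec_; _⊎-dec_; from-yes; from-no)

-- The three special points are handled at once: θ is a root of x² - t x + 1, every identity is
-- polynomial in t, and 1 - θ has norm 2 - t. For t = -2 the norm of f(θ) is f(-1)². M⁻_q(c) splits
-- into one turn (x , y) ↦ (x - y , x) and c - 1 shears (x , y) ↦ (θ x + y , y), all isometries of
-- one form, which has value 1 at the initial vector (1 , 0). Completing the square gives (1 - t)
-- |R(θ)|² ≤ 2 - t, so this norm is at most 2, 3/2, 4/3 for i, ω, -1. It is congruent to p² modulo 2
-- - t, hence odd (for i and -1) or prime to 3 (for ω) once p is neither 2 nor 3, which leaves only
-- 1. The seven nodes match the seven coefficients of a polynomial of degree at most 6; this is
-- where the bound 7 comes from. Positivity of a factor f on [0, ∞) follows from f h = S ≥ 1 there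
-- and f(0) = 1: f has no zero, hence no change of sign. The argument stays in ℚ, so the
-- intermediate value theorem is replaced by a walk in rational steps that are too short for a
-- change of sign.

-- Polynomials as coefficient lists over a commutative ring.

module Polynomial {A : Set} {_+_ _*_ : A → A → A} { -_ : A → A} {0# 1# : A}
  (isCommutativeRing : IsCommutativeRing _≡_ _+_ _*_ -_ 0# 1#) where

  open ≡-Reasoning

  private
    ring : CommutativeRing 0ℓ 0ℓ
    ring = record { isCommutativeRing = isCommutativeRing }

  open import Algebra.Solver.Ring.NaturalCoefficients.Default
    (CommutativeRing.commutativeSemiring ring)
  open CommutativeRing ring
    using (+-identityˡ; +-identityʳ; zeroˡ; zeroʳ; *-identityˡ; *-assoc; *-comm)

  infix  4 _≈ₚ_
  infixl 6 _⊕_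
  infixl 7 _⊗_ _⊙_

  coef : List A → ℕ → A
  coef []      _       = 0#
  coef (a ∷ f) zero    = a
  coef (a ∷ f) (suc n) = coef f n

  _≈ₚ_ : List A → List A → Set
  f ≈ₚ g = ∀ n → coef f n ≡ coef g n

  _⊕_ : List A → List A → List A
  []      ⊕ g       = g
  (a ∷ f) ⊕ []      = a ∷ f
  (a ∷ f) ⊕ (b ∷ g) = (a + b) ∷ (f ⊕ g)

  _⊙_ : A → List A → List A
  c ⊙ f = map (c *_) f

  _⊗_ : List A → List A → List A
  []      ⊗ g = []
  (a ∷ f) ⊗ g = (a ⊙ g) ⊕ (0# ∷ (f ⊗ g))

  eval : A → List A → A
  eval x []      = 0#
  eval x (a ∷ f) = a + (x * eval x f)

  coef-⊕ : ∀ f g n → coef (f ⊕ g) n ≡ coef f n + coef g n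
  coef-⊕ []      g       n       = sym (+-identityˡ _)
  coef-⊕ (a ∷ f) []      n       = sym (+-identityʳ _)
  coef-⊕ (a ∷ f) (b ∷ g) zero    = refl
  coef-⊕ (a ∷ f) (b ∷ g) (suc n) = coef-⊕ f g n

  coef-⊙ : ∀ c f n → coef (c ⊙ f) n ≡ c * coef f n
  coef-⊙ c []      n       = sym (zeroʳ c)
  coef-⊙ c (a ∷ f) zero    = refl
  coef-⊙ c (a ∷ f) (suc n) = coef-⊙ c f n

  coef-⊗-zero : ∀ f g → coef (f ⊗ g) 0 ≡ coef f 0 * coef g 0
  coef-⊗-zero []      g = sym (zeroˡ _)
  coef-⊗-zero (a ∷ f) g =
    trans (coef-⊕ (a ⊙ g) (0# ∷ (f ⊗ g)) 0)
      (trans (+-identityʳ _) (coef-⊙ a g 0))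

  coef-⊗-suc : ∀ a f g n →
    coef ((a ∷ f) ⊗ g) (suc n) ≡ (a * coef g (suc n)) + coef (f ⊗ g) n
  coef-⊗-suc a f g n =
    trans (coef-⊕ (a ⊙ g) (0# ∷ (f ⊗ g)) (suc n))
      (cong (_+ coef (f ⊗ g) n) (coef-⊙ a g (suc n)))

  -- Mirror image of `coef-⊗-suc`. The product recurses on its left factor only; this recursion on
  -- the right one drives `⊗-comm` and, later, the divisibility argument behind Gauss's lemma.
  coef-⊗-∷ : ∀ f b g n →
    coef (f ⊗ (b ∷ g)) (suc n) ≡ (b * coef f (suc n)) + coef (f ⊗ g) n
  coef-⊗-∷ []      b g n = trans (sym (zeroʳ b)) (sym (+-identityʳ _))
  coef-⊗-∷ (a ∷ f) b g zero = begin
    coef ((a ∷ f) ⊗ (b ∷ g)) 1             ≡⟨ coef-⊗-suc a f (b ∷ g) 0 ⟩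
    (a * coef g 0) + coef (f ⊗ (b ∷ g)) 0  ≡⟨ cong (λ z′ → (a * coef g 0) + z′) (coef-⊗-zero f (b ∷ g)) ⟩
    (a * coef g 0) + (coef f 0 * b)        ≡⟨ solve 3 (λ u v w → u :+ v :* w := w :* v :+ u) refl (a * coef g 0) (coef f 0) b ⟩
    (b * coef f 0) + (a * coef g 0)        ≡⟨ cong (λ z′ → (b * coef f 0) + z′) (coef-⊗-zero (a ∷ f) g) ⟨
    (b * coef f 0) + coef ((a ∷ f) ⊗ g) 0  ∎
  coef-⊗-∷ (a ∷ f) b g (suc n) = begin
    coef ((a ∷ f) ⊗ (b ∷ g)) (suc (suc n))
      ≡⟨ coef-⊗-suc a f (b ∷ g) (suc n) ⟩
    u + coef (f ⊗ (b ∷ g)) (suc n)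
      ≡⟨ cong (λ z′ → u + z′) (coef-⊗-∷ f b g n) ⟩
    u + (v + w)
      ≡⟨ solve 3 (λ x y z → x :+ (y :+ z) := y :+ (x :+ z)) refl u v w ⟩
    v + (u + w)
      ≡⟨ cong (λ z′ → v + z′) (coef-⊗-suc a f g n) ⟨
    v + coef ((a ∷ f) ⊗ g) (suc n) ∎
    where
    u = a * coef g (suc n)
    v = b * coef f (suc n)
    w = coef (f ⊗ g) n

  ⊗-congʳ : ∀ f {g h} → g ≈ₚ h → f ⊗ g ≈ₚ f ⊗ h
  ⊗-congʳ []      g≈h n = refl
  ⊗-congʳ (a ∷ f) {g} {h} g≈h zero =
    trans (coef-⊗-zero (a ∷ f) g)
      (trans (cong (a *_) (g≈h 0)) (sym (coef-⊗-zero (a ∷ f) h)))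
  ⊗-congʳ (a ∷ f) {g} {h} g≈h (suc n) =
    trans (coef-⊗-suc a f g n)
      (trans (cong₂ _+_ (cong (a *_) (g≈h (suc n))) (⊗-congʳ f g≈h n))
        (sym (coef-⊗-suc a f h n)))

  ⊗-comm : ∀ f g → f ⊗ g ≈ₚ g ⊗ f
  ⊗-comm f       g zero    =
    trans (coef-⊗-zero f g) (trans (*-comm _ _) (sym (coef-⊗-zero g f)))
  ⊗-comm []      []      (suc n) = refl
  ⊗-comm []      (b ∷ g) (suc n) =
    sym (trans (coef-⊗-suc b g [] n)
      (trans (cong₂ _+_ (zeroʳ b) (⊗-comm g [] n)) (+-identityʳ _)))
  ⊗-comm (a ∷ f) g (suc n) =
    trans (coef-⊗-suc a f g n)
      (trans (cong (λ z′ → (a * coef g (suc n)) + z′) (⊗-comm f g n)) (sym (coef-⊗-∷ g a f n)))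

  ⊗-congˡ : ∀ {f g} h → f ≈ₚ g → f ⊗ h ≈ₚ g ⊗ h
  ⊗-congˡ {f} {g} h f≈g n =
    trans (⊗-comm f h n) (trans (⊗-congʳ h f≈g n) (⊗-comm h g n))

  ⊙-⊗ : ∀ c f g → (c ⊙ f) ⊗ g ≈ₚ c ⊙ (f ⊗ g)
  ⊙-⊗ c []      g n    = refl
  ⊙-⊗ c (a ∷ f) g zero = begin
    coef ((c ⊙ (a ∷ f)) ⊗ g) 0  ≡⟨ coef-⊗-zero (c ⊙ (a ∷ f)) g ⟩
    (c * a) * coef g 0          ≡⟨ *-assoc c a _ ⟩
    c * (a * coef g 0)          ≡⟨ cong (c *_) (coef-⊗-zero (a ∷ f) g) ⟨
    c * coef ((a ∷ f) ⊗ g) 0    ≡⟨ coef-⊙ c ((a ∷ f) ⊗ g) 0 ⟨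
    coef (c ⊙ ((a ∷ f) ⊗ g)) 0  ∎
  ⊙-⊗ c (a ∷ f) g (suc n) = begin
    coef ((c ⊙ (a ∷ f)) ⊗ g) (suc n)
      ≡⟨ coef-⊗-suc (c * a) (c ⊙ f) g n ⟩
    ((c * a) * coef g (suc n)) + coef ((c ⊙ f) ⊗ g) n
      ≡⟨ cong (λ z′ → ((c * a) * coef g (suc n)) + z′) (trans (⊙-⊗ c f g n) (coef-⊙ c (f ⊗ g) n)) ⟩
    ((c * a) * coef g (suc n)) + (c * coef (f ⊗ g) n)
      ≡⟨ solve 4 (λ x y z w → x :* y :* z :+ x :* w := x :* (y :* z :+ w)) refl c a (coef g (suc n)) (coef (f ⊗ g) n) ⟩
    c * ((a * coef g (suc n)) + coef (f ⊗ g) n)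
      ≡⟨ cong (c *_) (coef-⊗-suc a f g n) ⟨
    c * coef ((a ∷ f) ⊗ g) (suc n)
      ≡⟨ coef-⊙ c ((a ∷ f) ⊗ g) (suc n) ⟨
    coef (c ⊙ ((a ∷ f) ⊗ g)) (suc n) ∎

  ⊙-cong : ∀ c {f g} → f ≈ₚ g → c ⊙ f ≈ₚ c ⊙ g
  ⊙-cong c {f} {g} f≈g n =
    trans (coef-⊙ c f n) (trans (cong (c *_) (f≈g n)) (sym (coef-⊙ c g n)))

  ⊗-⊙ : ∀ c f g → f ⊗ (c ⊙ g) ≈ₚ c ⊙ (f ⊗ g)
  ⊗-⊙ c f g n =
    trans (⊗-comm f (c ⊙ g) n)
      (trans (⊙-⊗ c g f n) (⊙-cong c {g ⊗ f} {f ⊗ g} (⊗-comm g f) n))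

  ⊙-⊙ : ∀ c d f → c ⊙ (d ⊙ f) ≈ₚ (c * d) ⊙ f
  ⊙-⊙ c d f n =
    trans (coef-⊙ c (d ⊙ f) n)
      (trans (cong (c *_) (coef-⊙ d f n))
        (trans (sym (*-assoc c d _)) (sym (coef-⊙ (c * d) f n))))

  1⊙ : ∀ f → 1# ⊙ f ≈ₚ f
  1⊙ f n = trans (coef-⊙ 1# f n) (*-identityˡ _)

  ⊗-constant : ∀ f c → f ⊗ (c ∷ []) ≈ₚ c ⊙ f
  ⊗-constant f c n = trans (⊗-comm f (c ∷ []) n)
    (trans (coef-⊕ (c ⊙ f) (0# ∷ []) n) (trans (cong (λ z′ → coef (c ⊙ f) n + z′) (zero-coef n)) (+-identityʳ _)))
    where
    zero-coef : ∀ n → coef (0# ∷ []) n ≡ 0#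
    zero-coef zero    = refl
    zero-coef (suc n) = refl

  Degree≤ : List A → ℕ → Set
  Degree≤ f d = ∀ n → d ℕ.< n → coef f n ≡ 0#

  ⊗-degree≤ : ∀ f g d e → Degree≤ f d → Degree≤ g e → Degree≤ (f ⊗ g) (d ℕ.+ e)
  ⊗-degree≤ []      g d       e f≤d g≤e n       lt = refl
  ⊗-degree≤ (a ∷ f) g zero    e f≤d g≤e (suc n) lt = begin
    coef ((a ∷ f) ⊗ g) (suc n)              ≡⟨ coef-⊗-suc a f g n ⟩
    (a * coef g (suc n)) + coef (f ⊗ g) n   ≡⟨ cong₂ _+_
        (cong (a *_) (g≤e (suc n) lt))
        (⊗-congˡ {f} {[]} g (λ m → f≤d (suc m) (ℕ.s≤s ℕ.z≤n)) n) ⟩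
    (a * 0#) + 0#                           ≡⟨ trans (+-identityʳ _) (zeroʳ a) ⟩
    0#                                      ∎
  ⊗-degree≤ (a ∷ f) g (suc d) e f≤d g≤e (suc n) (ℕ.s≤s lt) = begin
    coef ((a ∷ f) ⊗ g) (suc n)              ≡⟨ coef-⊗-suc a f g n ⟩
    (a * coef g (suc n)) + coef (f ⊗ g) n   ≡⟨ cong₂ _+_
        (cong (a *_) (g≤e (suc n) (ℕ.s≤s (ℕP.≤-trans (ℕP.m≤n+m e d) (ℕP.<⇒≤ lt)))))
        (⊗-degree≤ f g d e (λ m d<m → f≤d (suc m) (ℕ.s≤s d<m)) g≤e n lt) ⟩
    (a * 0#) + 0#                           ≡⟨ trans (+-identityʳ _) (zeroʳ a) ⟩
    0#                                      ∎

  ⊗-leading : ∀ f g d e → Degree≤ f d → Degree≤ g e →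
    coef (f ⊗ g) (d ℕ.+ e) ≡ coef f d * coef g e
  ⊗-leading []      g d       e f≤d g≤e = sym (zeroˡ _)
  ⊗-leading (a ∷ f) g zero    zero    f≤d g≤e = coef-⊗-zero (a ∷ f) g
  ⊗-leading (a ∷ f) g zero    (suc e) f≤d g≤e =
    trans (coef-⊗-suc a f g e)
      (trans (cong (λ z′ → (a * coef g (suc e)) + z′) (⊗-congˡ {f} {[]} g (λ m → f≤d (suc m) (ℕ.s≤s ℕ.z≤n)) e))
        (+-identityʳ _))
  ⊗-leading (a ∷ f) g (suc d) e f≤d g≤e =
    trans (coef-⊗-suc a f g (d ℕ.+ e))
      (trans (cong₂ _+_ (trans (cong (a *_) (g≤e (suc d ℕ.+ e) (ℕ.s≤s (ℕP.m≤n+m e d)))) (zeroʳ a))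
                        (⊗-leading f g d e (λ m d<m → f≤d (suc m) (ℕ.s≤s d<m)) g≤e))
        (+-identityˡ _))

  ≈-dec : DecidableEquality A → ∀ f g → Dec (f ≈ₚ g)
  ≈-dec _≟_ []      []      = yes (λ _ → refl)
  ≈-dec _≟_ []      (b ∷ g) = map′ ≈-∷ (λ 0≈g → 0≈g 0 , λ n → 0≈g (suc n))
    ((0# ≟ b) ×-dec ≈-dec _≟_ [] g)
    where
    ≈-∷ : 0# ≡ b × [] ≈ₚ g → [] ≈ₚ b ∷ g
    ≈-∷ (0≡b , 0≈g) zero    = 0≡b
    ≈-∷ (0≡b , 0≈g) (suc n) = 0≈g n
  ≈-dec _≟_ (a ∷ f) []      = map′ ≈-∷ (λ f≈0 → f≈0 0 , λ n → f≈0 (suc n))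
    ((a ≟ 0#) ×-dec ≈-dec _≟_ f [])
    where
    ≈-∷ : a ≡ 0# × f ≈ₚ [] → a ∷ f ≈ₚ []
    ≈-∷ (a≡0 , f≈0) zero    = a≡0
    ≈-∷ (a≡0 , f≈0) (suc n) = f≈0 n
  ≈-dec _≟_ (a ∷ f) (b ∷ g) = map′ ≈-∷ (λ f≈g → f≈g 0 , λ n → f≈g (suc n))
    ((a ≟ b) ×-dec ≈-dec _≟_ f g)
    where
    ≈-∷ : a ≡ b × f ≈ₚ g → a ∷ f ≈ₚ b ∷ g
    ≈-∷ (a≡b , f≈g) zero    = a≡b
    ≈-∷ (a≡b , f≈g) (suc n) = f≈g n

  degree : DecidableEquality A → ∀ f → f ≈ₚ [] ⊎ ∃ λ d → coef f d ≢ 0# × Degree≤ f d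
  degree _≟_ []      = inj₁ (λ _ → refl)
  degree _≟_ (a ∷ f) with degree _≟_ f
  ... | inj₂ (d , fd≢0 , f≤d) =
    inj₂ (suc d , fd≢0 , λ { (suc n) (ℕ.s≤s d<n) → f≤d n d<n })
  ... | inj₁ f≈0 with a ≟ 0#
  ...   | yes a≡0 = inj₁ (λ { zero → a≡0 ; (suc n) → f≈0 n })
  ...   | no  a≢0 = inj₂ (0 , a≢0 , λ { (suc n) _ → f≈0 n })

  eval-≈0 : ∀ x f → f ≈ₚ [] → eval x f ≡ 0#
  eval-≈0 x []      f≈0 = refl
  eval-≈0 x (a ∷ f) f≈0 = begin
    a + (x * eval x f) ≡⟨ cong₂ (λ u v → u + (x * v)) (f≈0 0) (eval-≈0 x f (λ n → f≈0 (suc n))) ⟩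
    0# + (x * 0#)      ≡⟨ trans (+-identityˡ _) (zeroʳ x) ⟩
    0#                 ∎

  eval-cong : ∀ x {f g} → f ≈ₚ g → eval x f ≡ eval x g
  eval-cong x {[]}    {g}     f≈g = sym (eval-≈0 x g (λ n → sym (f≈g n)))
  eval-cong x {a ∷ f} {[]}    f≈g = eval-≈0 x (a ∷ f) f≈g
  eval-cong x {a ∷ f} {b ∷ g} f≈g =
    cong₂ (λ u v → u + (x * v)) (f≈g 0) (eval-cong x {f} {g} (λ n → f≈g (suc n)))

  eval-⊕ : ∀ x f g → eval x (f ⊕ g) ≡ eval x f + eval x g
  eval-⊕ x []      g       = sym (+-identityˡ _)
  eval-⊕ x (a ∷ f) []      = sym (+-identityʳ _)
  eval-⊕ x (a ∷ f) (b ∷ g) =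
    trans (cong (λ u → (a + b) + (x * u)) (eval-⊕ x f g))
      (solve 5 (λ a b x u v → a :+ b :+ x :* (u :+ v) := a :+ x :* u :+ (b :+ x :* v)) refl
        a b x (eval x f) (eval x g))

  eval-⊙ : ∀ x c f → eval x (c ⊙ f) ≡ c * eval x f
  eval-⊙ x c []      = sym (zeroʳ c)
  eval-⊙ x c (a ∷ f) =
    trans (cong (λ u → (c * a) + (x * u)) (eval-⊙ x c f))
      (solve 4 (λ c a x u → c :* a :+ x :* (c :* u) := c :* (a :+ x :* u)) refl c a x (eval x f))

  eval-⊗ : ∀ x f g → eval x (f ⊗ g) ≡ eval x f * eval x g
  eval-⊗ x []      g = sym (zeroˡ _)
  eval-⊗ x (a ∷ f) g = begin
    eval x ((a ⊙ g) ⊕ (0# ∷ (f ⊗ g)))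
      ≡⟨ eval-⊕ x (a ⊙ g) (0# ∷ (f ⊗ g)) ⟩
    eval x (a ⊙ g) + (0# + (x * eval x (f ⊗ g)))
      ≡⟨ cong₂ (λ u v → u + (0# + (x * v))) (eval-⊙ x a g) (eval-⊗ x f g) ⟩
    (a * eval x g) + (0# + (x * (eval x f * eval x g)))
      ≡⟨ cong (λ z′ → (a * eval x g) + z′) (+-identityˡ _) ⟩
    (a * eval x g) + (x * (eval x f * eval x g))
      ≡⟨ solve 4 (λ a x u v → a :* v :+ x :* (u :* v) := (a :+ x :* u) :* v) refl a x (eval x f) (eval x g) ⟩
    (a + (x * eval x f)) * eval x g ∎

-- Change of coefficients along a ring homomorphism.

module BaseChange {A B : Set}
  {_+_ _*_ : A → A → A} { -_ : A → A} {0# 1# : A}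
  {_+′_ _*′_ : B → B → B} { -′_ : B → B} {0#′ 1#′ : B}
  (isA : IsCommutativeRing _≡_ _+_ _*_ -_ 0# 1#)
  (isB : IsCommutativeRing _≡_ _+′_ _*′_ -′_ 0#′ 1#′)
  (φ : A → B)
  (φ-0 : φ 0# ≡ 0#′)
  (φ-+ : ∀ a b → φ (a + b) ≡ φ a +′ φ b)
  (φ-* : ∀ a b → φ (a * b) ≡ φ a *′ φ b)
  where

  private
    module A[x] = Polynomial isA
    module B[x] = Polynomial isB

  coef-map : ∀ f n → B[x].coef (map φ f) n ≡ φ (A[x].coef f n)
  coef-map []      n       = sym φ-0
  coef-map (a ∷ f) zero    = refl
  coef-map (a ∷ f) (suc n) = coef-map f n

  map-≈ : ∀ {f g} → f A[x].≈ₚ g → map φ f B[x].≈ₚ map φ g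
  map-≈ {f} {g} f≈g n = trans (coef-map f n) (trans (cong φ (f≈g n)) (sym (coef-map g n)))

  map-⊕ : ∀ f g → map φ (f A[x].⊕ g) ≡ map φ f B[x].⊕ map φ g
  map-⊕ []      g       = refl
  map-⊕ (a ∷ f) []      = refl
  map-⊕ (a ∷ f) (b ∷ g) = cong₂ _∷_ (φ-+ a b) (map-⊕ f g)

  map-⊙ : ∀ c f → map φ (c A[x].⊙ f) ≡ φ c B[x].⊙ map φ f
  map-⊙ c []      = refl
  map-⊙ c (a ∷ f) = cong₂ _∷_ (φ-* c a) (map-⊙ c f)

  map-⊗ : ∀ f g → map φ (f A[x].⊗ g) ≡ map φ f B[x].⊗ map φ g
  map-⊗ []      g = refl
  map-⊗ (a ∷ f) g =
    trans (map-⊕ (a A[x].⊙ g) (0# ∷ (f A[x].⊗ g)))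
      (cong₂ B[x]._⊕_ (map-⊙ a g) (cong₂ _∷_ φ-0 (map-⊗ f g)))


-- Integer polynomials and their values in quadratic rings.

module ℤ[x] = Polynomial ℤP.+-*-isCommutativeRing

square≥0 : ∀ i → 0ℤ ℤ.≤ i ℤ.* i
square≥0 (+ n)    = subst (0ℤ ℤ.≤_) (ℤP.pos-* n n) (ℤ.+≤+ ℕ.z≤n)
square≥0 -[1+ n ] = ℤ.+≤+ ℕ.z≤n

product≥0 : ∀ {i j} → 0ℤ ℤ.≤ i → 0ℤ ℤ.≤ j → 0ℤ ℤ.≤ i ℤ.* j
product≥0 {+ m} {+ n} _ _ = subst (0ℤ ℤ.≤_) (ℤP.pos-* m n) (ℤ.+≤+ ℕ.z≤n)

-- ℤ[θ] with θ² = t θ - 1, the pair (a , b) standing for a + b θ.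
-- For t = 0, -1, -2 the element θ is i, a primitive cube root of unity, and
-- (up to a nilpotent) -1.
module Quadratic (t : ℤ) where
  open ℤ[x] using (_≈ₚ_; _⊕_; _⊙_; _⊗_; eval)
  open import Data.Integer using (_+_; _*_; -_; _-_; _≤_; _<_)

  infixl 6 _✚_
  infixl 7 _✖_

  _✚_ _✖_ : ℤ × ℤ → ℤ × ℤ → ℤ × ℤ
  (a , b) ✚ (c , d) = a + c , b + d
  (a , b) ✖ (c , d) = a * c - b * d , a * d + b * c + t * (b * d)

  ⊖_ : ℤ × ℤ → ℤ × ℤ
  ⊖ (a , b) = - a , - b

  private
    *-assoc₁ : ∀ t a b c d e f →
      (a * c - b * d) * e - (a * d + b * c + t * (b * d)) * f ≡
      a * (c * e - d * f) - b * (c * f + d * e + t * (d * f))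
    *-assoc₁ = solve-∀

    *-assoc₂ : ∀ t a b c d e f →
      (a * c - b * d) * f + (a * d + b * c + t * (b * d)) * e + t * ((a * d + b * c + t * (b * d)) * f) ≡
      a * (c * f + d * e + t * (d * f)) + b * (c * e - d * f) + t * (b * (c * f + d * e + t * (d * f)))
    *-assoc₂ = solve-∀

    *-comm₁ : ∀ a b c d → a * c - b * d ≡ c * a - d * b
    *-comm₁ = solve-∀

    *-comm₂ : ∀ t a b c d → a * d + b * c + t * (b * d) ≡ c * b + d * a + t * (d * b)
    *-comm₂ = solve-∀

    *-identity₁ : ∀ a b → 1ℤ * a - 0ℤ * b ≡ a
    *-identity₁ = solve-∀

    *-identity₂ : ∀ t a b → 1ℤ * b + 0ℤ * a + t * (0ℤ * b) ≡ b
    *-identity₂ = solve-∀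

    distrib₁ : ∀ a b c d e f → a * (c + e) - b * (d + f) ≡ a * c - b * d + (a * e - b * f)
    distrib₁ = solve-∀

    distrib₂ : ∀ t a b c d e f →
      a * (d + f) + b * (c + e) + t * (b * (d + f)) ≡
      a * d + b * c + t * (b * d) + (a * f + b * e + t * (b * f))
    distrib₂ = solve-∀

    ✖-comm : ∀ x y → x ✖ y ≡ y ✖ x
    ✖-comm (a , b) (c , d) = cong₂ _,_ (*-comm₁ a b c d) (*-comm₂ t a b c d)

    ✖-identityˡ : ∀ x → (1ℤ , 0ℤ) ✖ x ≡ x
    ✖-identityˡ (a , b) = cong₂ _,_ (*-identity₁ a b) (*-identity₂ t a b)

    ✖-distribˡ : ∀ x y z → x ✖ (y ✚ z) ≡ (x ✖ y) ✚ (x ✖ z)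
    ✖-distribˡ (a , b) (c , d) (e , f) =
      cong₂ _,_ (distrib₁ a b c d e f) (distrib₂ t a b c d e f)

  isCommutativeRing : IsCommutativeRing _≡_ _✚_ _✖_ ⊖_ (0ℤ , 0ℤ) (1ℤ , 0ℤ)
  isCommutativeRing = record
    { isRing = record
      { +-isAbelianGroup = record
        { isGroup = record
          { isMonoid = record
            { isSemigroup = record
              { isMagma = record { isEquivalence = isEquivalence ; ∙-cong = cong₂ _✚_ }
              ; assoc = λ { (a , b) (c , d) (e , f) → cong₂ _,_ (ℤP.+-assoc a c e) (ℤP.+-assoc b d f) }
              }
            ; identity = (λ { (a , b) → cong₂ _,_ (ℤP.+-identityˡ a) (ℤP.+-identityˡ b) })
                       , (λ { (a , b) → cong₂ _,_ (ℤP.+-identityʳ a) (ℤP.+-identityʳ b) })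
            }
          ; inverse = (λ { (a , b) → cong₂ _,_ (ℤP.+-inverseˡ a) (ℤP.+-inverseˡ b) })
                    , (λ { (a , b) → cong₂ _,_ (ℤP.+-inverseʳ a) (ℤP.+-inverseʳ b) })
          ; ⁻¹-cong = cong ⊖_
          }
        ; comm = λ { (a , b) (c , d) → cong₂ _,_ (ℤP.+-comm a c) (ℤP.+-comm b d) }
        }
      ; *-cong = cong₂ _✖_
      ; *-assoc = λ { (a , b) (c , d) (e , f) →
          cong₂ _,_ (*-assoc₁ t a b c d e f) (*-assoc₂ t a b c d e f) }
      ; *-identity = ✖-identityˡ , λ x → trans (✖-comm x (1ℤ , 0ℤ)) (✖-identityˡ x)
      ; distrib = ✖-distribˡ
                , λ x y z → trans (✖-comm (y ✚ z) x)
                    (trans (✖-distribˡ x y z) (cong₂ _✚_ (✖-comm x y) (✖-comm x z)))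
      }
    ; *-comm = ✖-comm
    }

  module Q[x] = Polynomial isCommutativeRing

  ι : ℤ → ℤ × ℤ
  ι a = a , 0ℤ

  private
    ι-*₁ : ∀ a b → a * b ≡ a * b - 0ℤ * 0ℤ
    ι-*₁ = solve-∀

    ι-*₂ : ∀ t a b → 0ℤ ≡ a * 0ℤ + 0ℤ * b + t * (0ℤ * 0ℤ)
    ι-*₂ = solve-∀

  module Coefficients = BaseChange ℤP.+-*-isCommutativeRing isCommutativeRing ι
    refl (λ a b → refl) (λ a b → cong₂ _,_ (ι-*₁ a b) (ι-*₂ t a b))

  θ : ℤ × ℤ
  θ = 0ℤ , 1ℤ

  at-θ : List ℤ → ℤ × ℤ
  at-θ f = Q[x].eval θ (map ι f)

  at-θ-cong : ∀ {f g} → f ≈ₚ g → at-θ f ≡ at-θ g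
  at-θ-cong {f} {g} f≈g = Q[x].eval-cong θ {map ι f} {map ι g} (Coefficients.map-≈ {f} {g} f≈g)

  at-θ-⊗ : ∀ f g → at-θ (f ⊗ g) ≡ at-θ f ✖ at-θ g
  at-θ-⊗ f g = trans (cong (Q[x].eval θ) (Coefficients.map-⊗ f g)) (Q[x].eval-⊗ θ (map ι f) (map ι g))

  at-θ-⊕ : ∀ f g → at-θ (f ⊕ g) ≡ at-θ f ✚ at-θ g
  at-θ-⊕ f g = trans (cong (Q[x].eval θ) (Coefficients.map-⊕ f g)) (Q[x].eval-⊕ θ (map ι f) (map ι g))

  at-θ-⊙ : ∀ c f → at-θ (c ⊙ f) ≡ ι c ✖ at-θ f
  at-θ-⊙ c f = trans (cong (Q[x].eval θ) (Coefficients.map-⊙ c f)) (Q[x].eval-⊙ θ (ι c) (map ι f))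

  -- Multiplication by θ sends a + b θ to -b + (a + t b) θ. On a list of explicit length this
  -- unfolds to a short expression in the coefficients, unlike `at-θ` with its products by 0 and 1.
  horner : List ℤ → ℤ × ℤ
  horner []      = 0ℤ , 0ℤ
  horner (c ∷ f) = c - proj₂ (horner f) , proj₁ (horner f) + t * proj₂ (horner f)

  at-θ≡horner : ∀ f → at-θ f ≡ horner f
  at-θ≡horner []      = refl
  at-θ≡horner (c ∷ f) = trans (cong (λ x → ι c ✚ (θ ✖ x)) (at-θ≡horner f))
    (cong₂ _,_ (step₁ c (proj₁ (horner f)) (proj₂ (horner f))) (step₂ t (proj₁ (horner f)) (proj₂ (horner f))))
    where
    step₁ : ∀ c a b → c + (0ℤ * a - 1ℤ * b) ≡ c - b
    step₁ = solve-∀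
    step₂ : ∀ t a b → 0ℤ + (0ℤ * b + 1ℤ * a + t * (1ℤ * b)) ≡ a + t * b
    step₂ = solve-∀

  norm : ℤ × ℤ → ℤ
  norm (a , b) = a * a + t * (a * b) + b * b

  private
    norm-*-identity : ∀ t a b c d →
      (a * c - b * d) * (a * c - b * d) +
        t * ((a * c - b * d) * (a * d + b * c + t * (b * d))) +
        (a * d + b * c + t * (b * d)) * (a * d + b * c + t * (b * d)) ≡
      (a * a + t * (a * b) + b * b) * (c * c + t * (c * d) + d * d)
    norm-*-identity = solve-∀

  norm-✖ : ∀ x y → norm (x ✖ y) ≡ norm x * norm y
  norm-✖ (a , b) (c , d) = norm-*-identity t a b c d

  -- |x|² + |y|² + Tr (β x ȳ) for β = θ / (1 - θ), the only form (up to a scalar)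
  -- that is invariant under both steps (x , y) ↦ (x - y , x) and
  -- (x , y) ↦ (θ x + y , y).
  form : ℤ × ℤ → ℤ × ℤ → ℤ
  form (a , b) (c , d) =
    norm (a , b) + norm (c , d) - (a * c + b * d - a * d + (t + 1ℤ) * (b * c))

  private
    form-turn-identity : ∀ t a b c d →
      let a′ = a + (- 1ℤ * c - 0ℤ * d)
          b′ = b + (- 1ℤ * d + 0ℤ * c + t * (0ℤ * d)) in
      (a′ * a′ + t * (a′ * b′) + b′ * b′) + (a * a + t * (a * b) + b * b)
        - (a′ * a + b′ * b - a′ * b + (t + 1ℤ) * (b′ * a)) ≡
      (a * a + t * (a * b) + b * b) + (c * c + t * (c * d) + d * d)
        - (a * c + b * d - a * d + (t + 1ℤ) * (b * c))
    form-turn-identity = solve-∀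

    form-shear-identity : ∀ t a b c d →
      let a′ = c + (0ℤ + (0ℤ * a - 1ℤ * b))
          b′ = d + (0ℤ + (0ℤ * b + 1ℤ * a + t * (1ℤ * b))) in
      (a′ * a′ + t * (a′ * b′) + b′ * b′) + (c * c + t * (c * d) + d * d)
        - (a′ * c + b′ * d - a′ * d + (t + 1ℤ) * (b′ * c)) ≡
      (a * a + t * (a * b) + b * b) + (c * c + t * (c * d) + d * d)
        - (a * c + b * d - a * d + (t + 1ℤ) * (b * c))
    form-shear-identity = solve-∀

    -- The square completed in y: z + w θ equals m y - (1 - θ) x, and m = 2 - t is the norm of 1 -
    -- θ. Dropping this square, whose norm is nonnegative, leaves the bound on |x|² in `norm-bound`.
    form-square-identity : ∀ t a b c d →
      let m = + 2 - t
          z = m * c - a - b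
          w = m * d + a + t * b - b in
      m * m * ((a * a + t * (a * b) + b * b) + (c * c + t * (c * d) + d * d)
        - (a * c + b * d - a * d + (t + 1ℤ) * (b * c))) ≡
      (z * z + t * (z * w) + w * w) + m * (1ℤ - t) * (a * a + t * (a * b) + b * b)
    form-square-identity = solve-∀

    four-norm-identity : ∀ t a b →
      + 4 * (a * a + t * (a * b) + b * b) ≡
      (+ 2 * a + t * b) * (+ 2 * a + t * b) + (+ 2 - t) * (+ 2 + t) * (b * b)
    four-norm-identity = solve-∀

    norm-mod-identity : ∀ t a b k →
      a * a + t * (a * b) + b * b ≡
      (a + b + (+ 2 - t) * k) * (a + b + (+ 2 - t) * k) +
        (+ 2 - t) * - (a * b + k * (a + b + (+ 2 - t) * k) + k * (a + b))
    norm-mod-identity = solve-∀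

  form-turn : ∀ x y → form (x ✚ (ι (- 1ℤ) ✖ y)) x ≡ form x y
  form-turn (a , b) (c , d) = form-turn-identity t a b c d

  form-shear : ∀ x y → form (y ✚ (ι 0ℤ ✚ (θ ✖ x))) y ≡ form x y
  form-shear (a , b) (c , d) = form-shear-identity t a b c d

  module _ (0≤4-t² : 0ℤ ≤ (+ 2 - t) * (+ 2 + t)) where

    norm≥0 : ∀ x → 0ℤ ≤ norm x
    norm≥0 (a , b) = ℤP.*-cancelˡ-≤-pos 0ℤ (norm (a , b)) (+ 4)
      (subst (0ℤ ≤_) (sym (four-norm-identity t a b))
        (ℤP.+-mono-≤ (square≥0 (+ 2 * a + t * b)) (product≥0 0≤4-t² (square≥0 b))))

    norm-bound : (+ 0 < + 2 - t) → ∀ x y → form x y ≡ 1ℤ →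
      (1ℤ - t) * norm x ≤ + 2 - t
    norm-bound 0<m x@(a , b) y@(c , d) form≡1 =
      ℤP.*-cancelˡ-≤-pos _ _ m {{ℤ.positive 0<m}}
        (subst₂ _≤_ (ℤP.*-assoc m (1ℤ - t) (norm x)) m²≡
          (subst (m * (1ℤ - t) * norm x ≤_) (sym (form-square-identity t a b c d))
            (subst (_≤ norm z + m * (1ℤ - t) * norm x) (ℤP.+-identityˡ _)
              (ℤP.+-monoˡ-≤ (m * (1ℤ - t) * norm x) (norm≥0 z)))))
      where
      m = + 2 - t
      z = m * c - a - b , m * d + a + t * b - b
      m²≡ : m * m * form x y ≡ m * m
      m²≡ = trans (cong (m * m *_) form≡1) (ℤP.*-identityʳ (m * m))

  -- At 1 the polynomial x² - t x + 1 takes the value 2 - t, so θ ↦ 1 is a homomorphism from ℤ[θ] to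
  -- ℤ/(2 - t). It carries f(θ) to f(1), and a + b θ to a + b.
  at-θ-mod : ∀ f → ∃ λ k → eval 1ℤ f ≡ proj₁ (at-θ f) + proj₂ (at-θ f) + (+ 2 - t) * k
  at-θ-mod []      = 0ℤ , sym (trans (ℤP.+-identityˡ _) (ℤP.*-zeroʳ (+ 2 - t)))
  at-θ-mod (c ∷ f) with at-θ f | at-θ-mod f
  ... | a , b | k , eq = k + b , trans (cong (λ u → c + 1ℤ * u) eq) (horner-identity t a b c k)
    where
    horner-identity : ∀ t a b c k → c + 1ℤ * (a + b + (+ 2 - t) * k) ≡
      (c + (0ℤ * a - 1ℤ * b)) + (0ℤ + (0ℤ * b + 1ℤ * a + t * (1ℤ * b))) + (+ 2 - t) * (k + b)
    horner-identity = solve-∀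

  norm-mod : ∀ f → ∃ λ k → norm (at-θ f) ≡ eval 1ℤ f * eval 1ℤ f + (+ 2 - t) * k
  norm-mod f with at-θ f | at-θ-mod f
  ... | a , b | k , eq =
    - (a * b + k * (a + b + (+ 2 - t) * k) + k * (a + b)) ,
    trans (norm-mod-identity t a b k)
      (cong (λ u → u * u + (+ 2 - t) * - (a * b + k * (a + b + (+ 2 - t) * k) + k * (a + b))) (sym eq))

-- The q-deformed continued fraction over ℤ.

module _ where
  open ℤ[x]
  open import Data.Integer using (∣_∣)
  open ≡-Reasoning

  -- [k + 1] R - q^k S, computed by Horner's rule in k.
  convergent : ℕ → List ℤ → List ℤ → List ℤ
  convergent zero    R S = R ⊕ (ℤ.- 1ℤ) ⊙ S
  convergent (suc k) R S = R ⊕ (0ℤ ∷ convergent k R S)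

  -- A function rather than a let: a let would be inlined and evaluation of RS
  -- become exponential.
  prepend : ℕ → List ℤ × List ℤ → List ℤ × List ℤ
  prepend k (R , S) = convergent k R S , R

  -- A copy of `RSgt1` over ℤ, so that the finite table is computed with integers and the
  -- polynomials can be evaluated in ℤ[θ]. `RS-correct` identifies the two.
  RS : ℕ → ℕ → ℕ → List ℤ × List ℤ
  RS zero    n d       = [] , []
  RS (suc f) n zero    = [] , []
  RS (suc f) n (suc d) with n % suc d ℕ.≟ 0
  ... | yes _ = convergent (n / suc d ∸ 1) (1ℤ ∷ []) [] , 1ℤ ∷ []
  ... | no  _ =
    prepend (n / suc d) (RS f (suc d) (suc d ∸ n % suc d))

  -- The pairs (R , S) attached to n / d > 1, where n / d need not be in lowest
  -- terms; the expansion starts from ∞ = g / 0.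
  data QRational : ℕ → ℕ → List ℤ → List ℤ → Set where
    infinity : ∀ g → QRational g 0 (1ℤ ∷ []) []
    step     : ∀ {n d R S} k m → m ℕ.+ d ≡ suc (suc k) ℕ.* n →
               QRational n d R S → QRational m n (convergent (suc k) R S) R

  -- The condition d < n makes every partial quotient at least 2, and it is inherited because the
  -- next pair is d over d - (n mod d) with a nonzero remainder. Denominators drop strictly, so fuel
  -- d is enough. An exact division ends the expansion at `infinity`, with the last denominator as
  -- g.
  RS-qRational : ∀ f n d → 0 ℕ.< d → d ℕ.≤ f → d ℕ.< n →
    QRational n d (proj₁ (RS f n d)) (proj₂ (RS f n d))
  RS-qRational (suc f) n (suc d) _ (ℕ.s≤s d≤f) d<n with n % suc d ℕ.≟ 0
  ... | yes r≡0 = last (n / suc d) n≡qd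
    where
    n≡qd : n ≡ (n / suc d) ℕ.* suc d
    n≡qd = trans (m≡m%n+[m/n]*n n (suc d)) (cong (ℕ._+ (n / suc d) ℕ.* suc d) r≡0)

    last : ∀ q → n ≡ q ℕ.* suc d →
      QRational n (suc d) (convergent (q ∸ 1) (1ℤ ∷ []) []) (1ℤ ∷ [])
    last zero          n≡ = contradiction (subst (suc d ℕ.<_) n≡ d<n) λ ()
    last (suc zero)    n≡ =
      contradiction (subst (suc d ℕ.<_) (trans n≡ (ℕP.+-identityʳ (suc d))) d<n) (ℕP.<-irrefl refl)
    last (suc (suc k)) n≡ = step k n (trans (ℕP.+-identityʳ n) n≡) (infinity (suc d))
  ... | no  r≢0 = next (n / suc d) (m≡m%n+[m/n]*n n (suc d))
    where
    r = n % suc d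
    r<d : r ℕ.< suc d
    r<d = m%n<n n (suc d)

    rec : QRational (suc d) (suc d ∸ r) (proj₁ (RS f (suc d) (suc d ∸ r))) (proj₂ (RS f (suc d) (suc d ∸ r)))
    rec = RS-qRational f (suc d) (suc d ∸ r) (ℕP.m<n⇒0<n∸m r<d)
      (ℕP.≤-trans (ℕP.≤-pred (ℕP.∸-monoʳ-< (ℕP.n≢0⇒n>0 r≢0) (ℕP.<⇒≤ r<d))) d≤f)
      (ℕP.∸-monoʳ-< (ℕP.n≢0⇒n>0 r≢0) (ℕP.<⇒≤ r<d))

    next : ∀ q → n ≡ r ℕ.+ q ℕ.* suc d →
      let rs = RS f (suc d) (suc d ∸ r) in
      QRational n (suc d) (convergent q (proj₁ rs) (proj₂ rs)) (proj₁ rs)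
    next zero    n≡ =
      contradiction (ℕP.<-trans r<d (subst (suc d ℕ.<_) (trans n≡ (ℕP.+-identityʳ r)) d<n)) (ℕP.<-irrefl refl)
    next (suc k) n≡ = step k n eq rec
      where
      eq : n ℕ.+ (suc d ∸ r) ≡ suc (suc k) ℕ.* suc d
      eq = begin
        n ℕ.+ (suc d ∸ r)                              ≡⟨ cong (ℕ._+ (suc d ∸ r)) (trans n≡ (ℕP.+-comm r _)) ⟩
        (suc k ℕ.* suc d ℕ.+ r) ℕ.+ (suc d ∸ r)       ≡⟨ ℕP.+-assoc (suc k ℕ.* suc d) r _ ⟩
        suc k ℕ.* suc d ℕ.+ (r ℕ.+ (suc d ∸ r))       ≡⟨ cong (suc k ℕ.* suc d ℕ.+_) (ℕP.m+[n∸m]≡n (ℕP.<⇒≤ r<d)) ⟩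
        suc k ℕ.* suc d ℕ.+ suc d                      ≡⟨ ℕP.+-comm (suc k ℕ.* suc d) (suc d) ⟩
        suc (suc k) ℕ.* suc d                           ∎

  NonNegative : List ℤ → Set
  NonNegative f = ∀ n → 0ℤ ℤ.≤ coef f n

  coef-shear : ∀ k R S n → coef (convergent (suc k) R S) n ≡ coef R n ℤ.+ coef (0ℤ ∷ convergent k R S) n
  coef-shear k R S n = coef-⊕ R (0ℤ ∷ convergent k R S) n

  coef-turn : ∀ R S n → coef (convergent 0 R S) n ≡ coef R n ℤ.+ ℤ.- 1ℤ ℤ.* coef S n
  coef-turn R S n = trans (coef-⊕ R ((ℤ.- 1ℤ) ⊙ S) n) (cong (λ u → coef R n ℤ.+ u) (coef-⊙ (ℤ.- 1ℤ) S n))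

  -- Nonnegativity of R alone is not inductive; that of R - S is added because the
  -- condition c ≥ 2 on the partial quotients preserves the pair.
  qRational-nonNegative : ∀ {n d R S} → QRational n d R S →
    NonNegative R × NonNegative (convergent 0 R S)
  qRational-nonNegative (infinity g) =
    (λ { zero → ℤ.+≤+ ℕ.z≤n ; (suc n) → ℤ.+≤+ ℕ.z≤n }) , λ { zero → ℤ.+≤+ ℕ.z≤n ; (suc n) → ℤ.+≤+ ℕ.z≤n }
  qRational-nonNegative (step {R = R} {S} k m eq q) =
    convergent≥0 (suc k) , λ n → subst (0ℤ ℤ.≤_) (sym (difference n)) (shifted≥0 k n)
    where
    shifted≥0 : ∀ k n → 0ℤ ℤ.≤ coef (0ℤ ∷ convergent k R S) n
    convergent≥0 : ∀ k → NonNegative (convergent k R S)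
    shifted≥0 k zero    = ℤ.+≤+ ℕ.z≤n
    shifted≥0 k (suc n) = convergent≥0 k n
    convergent≥0 zero    n = proj₂ (qRational-nonNegative q) n
    convergent≥0 (suc k) n = subst (0ℤ ℤ.≤_) (sym (coef-shear k R S n))
      (ℤP.+-mono-≤ (proj₁ (qRational-nonNegative q) n) (shifted≥0 k n))

    cancel : ∀ x y → (x ℤ.+ y) ℤ.+ ℤ.- 1ℤ ℤ.* x ≡ y
    cancel = solve-∀

    difference : ∀ n → coef (convergent 0 (convergent (suc k) R S) R) n ≡ coef (0ℤ ∷ convergent k R S) n
    difference n = trans (coef-turn (convergent (suc k) R S) R n)
      (trans (cong (ℤ._+ ℤ.- 1ℤ ℤ.* coef R n) (coef-shear k R S n)) (cancel (coef R n) _))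

  qRational-constant : ∀ {n d R S} → QRational n d R S → coef R 0 ≡ 1ℤ
  qRational-constant (infinity g) = refl
  qRational-constant (step {R = R} {S} k m eq q) =
    trans (coef-shear k R S 0) (trans (ℤP.+-identityʳ _) (qRational-constant q))

  -- The last component says that S has smaller degree than R. It keeps the term q^k S from touching
  -- the leading coefficient in the next step, and it is restored there because a shear raises the
  -- degree.
  qRational-monic : ∀ {n d R S} → QRational n d R S →
    ∃ λ e → coef R e ≡ 1ℤ × Degree≤ R e × (∀ j → e ℕ.≤ j → coef S j ≡ 0ℤ)
  qRational-monic (infinity g) = 0 , refl , (λ { (suc j) _ → refl }) , λ j _ → refl
  qRational-monic (step {R = R} {S} k m eq q) with qRational-monic q
  ... | e , R≡1 , R≤e , S<e =
    suc k ℕ.+ e , proj₁ (top (suc k)) , proj₂ (top (suc k)) ,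
    λ j e<j → R≤e j (ℕP.≤-trans (ℕ.s≤s (ℕP.m≤n+m e k)) e<j)
    where
    top : ∀ k → coef (convergent k R S) (k ℕ.+ e) ≡ 1ℤ × Degree≤ (convergent k R S) (k ℕ.+ e)
    top zero =
      trans (coef-turn R S e) (cong₂ (λ x y → x ℤ.+ ℤ.- 1ℤ ℤ.* y) R≡1 (S<e e ℕP.≤-refl)) ,
      λ j e<j → trans (coef-turn R S j)
        (cong₂ (λ x y → x ℤ.+ ℤ.- 1ℤ ℤ.* y) (R≤e j e<j) (S<e j (ℕP.<⇒≤ e<j)))
    top (suc k) =
      trans (coef-shear k R S (suc k ℕ.+ e))
        (cong₂ ℤ._+_ (R≤e (suc k ℕ.+ e) (ℕ.s≤s (ℕP.m≤n+m e k))) (proj₁ (top k))) ,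
      λ { (suc j) (ℕ.s≤s lt) → trans (coef-shear k R S (suc j))
        (cong₂ ℤ._+_ (R≤e (suc j) (ℕ.s≤s (ℕP.≤-trans (ℕP.m≤n+m e k) (ℕP.<⇒≤ lt)))) (proj₂ (top k) j lt)) }

  convergent-at-1 : ∀ k R S →
    eval 1ℤ (convergent k R S) ≡ + suc k ℤ.* eval 1ℤ R ℤ.- eval 1ℤ S
  convergent-at-1 zero R S =
    trans (eval-⊕ 1ℤ R ((ℤ.- 1ℤ) ⊙ S))
      (trans (cong (λ u → eval 1ℤ R ℤ.+ u) (eval-⊙ 1ℤ (ℤ.- 1ℤ) S)) (base (eval 1ℤ R) (eval 1ℤ S)))
    where
    base : ∀ x y → x ℤ.+ ℤ.- 1ℤ ℤ.* y ≡ 1ℤ ℤ.* x ℤ.- y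
    base = solve-∀
  convergent-at-1 (suc k) R S =
    trans (eval-⊕ 1ℤ R (0ℤ ∷ convergent k R S))
      (trans (cong (λ u → eval 1ℤ R ℤ.+ (0ℤ ℤ.+ 1ℤ ℤ.* u)) (convergent-at-1 k R S))
        (induct (+ suc k) (eval 1ℤ R) (eval 1ℤ S)))
    where
    induct : ∀ c x y → x ℤ.+ (0ℤ ℤ.+ 1ℤ ℤ.* (c ℤ.* x ℤ.- y)) ≡ (1ℤ ℤ.+ c) ℤ.* x ℤ.- y
    induct = solve-∀

  -- At q = 1 the recursion becomes R′ = c R - S, which is the one that numerators and denominators
  -- obey; hence (n , d) stays a fixed multiple g of (R(1) , S(1)).
  qRational-at-1 : ∀ {n d R S} → QRational n d R S →
    ∃ λ g → + n ≡ g ℤ.* eval 1ℤ R × + d ≡ g ℤ.* eval 1ℤ S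
  qRational-at-1 (infinity g) =
    + g , sym (ℤP.*-identityʳ (+ g)) , sym (ℤP.*-zeroʳ (+ g))
  qRational-at-1 (step {n} {d} {R} {S} k m eq q) with qRational-at-1 q
  ... | g , n≡ , d≡ = g , m≡ , n≡
    where
    c = + suc (suc k)
    regroup : ∀ c g x y → c ℤ.* (g ℤ.* x) ℤ.- g ℤ.* y ≡ g ℤ.* (c ℤ.* x ℤ.- y)
    regroup = solve-∀
    split : ∀ m d → m ≡ (m ℤ.+ d) ℤ.- d
    split = solve-∀
    m≡ : + m ≡ g ℤ.* eval 1ℤ (convergent (suc k) R S)
    m≡ = begin
      + m                                       ≡⟨ split (+ m) (+ d) ⟩
      + (m ℕ.+ d) ℤ.- + d                       ≡⟨ cong (λ u → + u ℤ.- + d) eq ⟩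
      + (suc (suc k) ℕ.* n) ℤ.- + d             ≡⟨ cong (ℤ._- + d) (ℤP.pos-* (suc (suc k)) n) ⟩
      c ℤ.* + n ℤ.- + d                         ≡⟨ cong₂ (λ u v → c ℤ.* u ℤ.- v) n≡ d≡ ⟩
      c ℤ.* (g ℤ.* eval 1ℤ R) ℤ.- g ℤ.* eval 1ℤ S ≡⟨ regroup c g (eval 1ℤ R) (eval 1ℤ S) ⟩
      g ℤ.* (c ℤ.* eval 1ℤ R ℤ.- eval 1ℤ S)     ≡⟨ cong (g ℤ.*_) (convergent-at-1 (suc k) R S) ⟨
      g ℤ.* eval 1ℤ (convergent (suc k) R S)     ∎

  module _ (t : ℤ) where
    open Quadratic t

    -- In Horner form `convergent k` is one turn followed by k shears, so invariance under these two
    -- moves is all that is used.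
    form-convergent : ∀ k R S → form (at-θ (convergent k R S)) (at-θ R) ≡ form (at-θ R) (at-θ S)
    form-convergent zero R S =
      trans (cong (λ u → form u (at-θ R))
               (trans (at-θ-⊕ R ((ℤ.- 1ℤ) ⊙ S)) (cong (at-θ R ✚_) (at-θ-⊙ (ℤ.- 1ℤ) S))))
        (form-turn (at-θ R) (at-θ S))
    form-convergent (suc k) R S =
      trans (cong (λ u → form u (at-θ R)) (at-θ-⊕ R (0ℤ ∷ convergent k R S)))
        (trans (form-shear (at-θ (convergent k R S)) (at-θ R)) (form-convergent k R S))

    qRational-form : ∀ {n d R S} → QRational n d R S → form (at-θ R) (at-θ S) ≡ 1ℤ
    qRational-form (infinity g) = initial t
      where
      -- Here a and b are what `at-θ` of the constant 1 unfolds to, written out for the ring solver.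
      initial : ∀ t →
        let a = 1ℤ ℤ.+ (0ℤ ℤ.* 0ℤ ℤ.- 1ℤ ℤ.* 0ℤ)
            b = 0ℤ ℤ.+ (0ℤ ℤ.* 0ℤ ℤ.+ 1ℤ ℤ.* 0ℤ ℤ.+ t ℤ.* (1ℤ ℤ.* 0ℤ)) in
        (a ℤ.* a ℤ.+ t ℤ.* (a ℤ.* b) ℤ.+ b ℤ.* b) ℤ.+ (0ℤ ℤ.* 0ℤ ℤ.+ t ℤ.* (0ℤ ℤ.* 0ℤ) ℤ.+ 0ℤ ℤ.* 0ℤ)
          ℤ.- (a ℤ.* 0ℤ ℤ.+ b ℤ.* 0ℤ ℤ.- a ℤ.* 0ℤ ℤ.+ (t ℤ.+ 1ℤ) ℤ.* (b ℤ.* 0ℤ)) ≡ 1ℤ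
      initial = solve-∀
    qRational-form (step {R = R} {S} k m eq q) =
      trans (form-convergent (suc k) R S) (qRational-form q)

  -- Interpolation candidates and the finite computation.

  numerator : ℕ → ℕ → List ℤ
  numerator p s = proj₁ (RS (p ∸ 1) p s)

  -- Integer polynomials form a lattice of index 2 among the node values, because x + 1 and x² + 1
  -- have resultant 2. For the data tried here a + b and e are odd, so every argument of `half` is
  -- even and the rounding never takes effect.
  half : ℤ → ℤ
  half (+ n)    = + (n / 2)
  half -[1+ n ] = ℤ.- + (suc n / 2)

  half-double : ∀ z → half (+ 2 ℤ.* z) ≡ z
  half-double (+ n) = trans (cong half (sym (ℤP.pos-* 2 n)))
    (cong +_ (trans (cong (_/ 2) (ℕP.*-comm 2 n)) (m*n/n≡m n 2)))
  half-double -[1+ n ] = cong (λ k → ℤ.- + k)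
    (trans (cong (_/ 2) (ℕP.*-comm 2 (suc n))) (m*n/n≡m (suc n) 2))

  -- Once f₂ and f₃ are known, the real part at i and both coordinates at ω give f₄, f₅ and f₁
  -- without division. The two remaining data, b and e, then determine f₂ and f₃ at the cost of one
  -- halving each.
  assemble : (l a c d f₂ f₃ : ℤ) → List ℤ
  assemble l a c d f₂ f₃ = 1ℤ ∷ f₁ ∷ f₂ ∷ f₃ ∷ f₄ ∷ f₅ ∷ l ∷ []
    where
    open import Data.Integer using (_+_; _-_)
    f₄ = a - 1ℤ + l + f₂
    f₅ = 1ℤ + f₃ + l - c - f₂
    f₁ = d + f₂ + f₅ - f₄

  -- The polynomial f of degree at most 6 with f(0) = 1, leading term l x⁶,
  -- f(i) = a + b i, f(-1) = e and f(ω) = c + d ω.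
  interpolant : ℤ → ℤ × ℤ → ℤ → ℤ × ℤ → List ℤ
  interpolant l (a , b) e (c , d) = assemble l a c d f₂ (half (a - e - b) + l + f₂)
    where
    open import Data.Integer using (_+_; _-_; _*_)
    f₂ = half (+ 2 * d + + 6 + + 4 * l - + 4 * c - a - e - + 3 * b)

  -- The value at 3 turns out to rule out every numerator other than f itself.
  TableRow : List ℤ → ℕ → Set
  TableRow f p = All (λ s → f ≈ₚ numerator p (suc s) ⊎ ¬ eval (+ 3) f ℤᵤ.∣ eval (+ 3) (numerator p (suc s))) (upTo (p ∸ 1))

  -- The candidate itself names the prime: unless f(1) = 1, the only p to consider is f(1), so p
  -- never enters as an unbounded parameter. The cheap tests stand before the table.
  Excluded : List ℤ → Set
  Excluded f =
    eval 1ℤ f ℤ.≤ 0ℤ ⊎ eval (+ 2) f ℤ.≤ 0ℤ ⊎ f ≈ₚ (1ℤ ∷ []) ⊎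
    (eval 1ℤ f ≢ 1ℤ × TableRow f ∣ eval 1ℤ f ∣)

  excluded? : ∀ f → Dec (Excluded f)
  excluded? f =
    (eval 1ℤ f ℤ.≤? 0ℤ) ⊎-dec (eval (+ 2) f ℤ.≤? 0ℤ) ⊎-dec ≈-dec ℤ._≟_ f (1ℤ ∷ []) ⊎-dec
    (¬? (eval 1ℤ f ℤ.≟ 1ℤ) ×-dec all?
      (λ s → ≈-dec ℤ._≟_ f (numerator p (suc s)) ⊎-dec
             ¬? (ℤ.∣ eval (+ 3) f ∣ ℕ∣.∣? ℤ.∣ eval (+ 3) (numerator p (suc s)) ∣))
      (upTo (p ∸ 1)))
    where p = ℤ.∣ eval 1ℤ f ∣

  signs : List ℤ
  signs = 1ℤ ∷ ℤ.- 1ℤ ∷ []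

  gaussianUnits eisensteinUnits : List (ℤ × ℤ)
  gaussianUnits = (1ℤ , 0ℤ) ∷ (0ℤ , 1ℤ) ∷ (ℤ.- 1ℤ , 0ℤ) ∷ (0ℤ , ℤ.- 1ℤ) ∷ []
  eisensteinUnits = (1ℤ , 0ℤ) ∷ (0ℤ , 1ℤ) ∷ (1ℤ , 1ℤ) ∷ (ℤ.- 1ℤ , 0ℤ) ∷ (0ℤ , ℤ.- 1ℤ) ∷ (ℤ.- 1ℤ , ℤ.- 1ℤ) ∷ []

  -- Decided by evaluation during type checking. There is one `All` for each node datum, so that
  -- four membership proofs select a case.
  interpolants-excluded :
    All (λ l → All (λ u → All (λ e → All (λ v → Excluded (interpolant l u e v))
      eisensteinUnits) signs) gaussianUnits) (0ℤ ∷ signs)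
  interpolants-excluded = from-yes
    (all? (λ l → all? (λ u → all? (λ e → all? (λ v → excluded? (interpolant l u e v))
      eisensteinUnits) signs) gaussianUnits) (0ℤ ∷ signs))

-- Gauss's lemma.

module ℚ[x] = Polynomial ℚP.+-*-isCommutativeRing

module _ where
  open ℤ[x]
  open import Data.List.Relation.Unary.All using ([]; _∷_)

  Divisible : ℕ → List ℤ → Set
  Divisible ℓ f = ∀ n → + ℓ ∣ coef f n

  euclid : ∀ {ℓ} → Prime ℓ → ∀ a b → + ℓ ∣ a ℤ.* b → + ℓ ∣ a ⊎ + ℓ ∣ b
  euclid {ℓ} pr a b ℓ∣ab
    with euclidsLemma ℤ.∣ a ∣ ℤ.∣ b ∣ pr (subst (ℓ ℕ∣.∣_) (ℤP.abs-* a b) (ℤ∣.∣⇒∣ᵤ ℓ∣ab))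
  ... | inj₁ ℓ∣a = inj₁ (ℤ∣.∣ᵤ⇒∣ ℓ∣a)
  ... | inj₂ ℓ∣b = inj₂ (ℤ∣.∣ᵤ⇒∣ ℓ∣b)

  -- The lowest coefficient of the product is f(0) b, which forces ℓ to divide b. Subtracting b f
  -- and shifting down leaves the same situation for a shorter g.
  divisible-cofactor : ∀ {ℓ} → Prime ℓ → ∀ f g → ¬ (+ ℓ ∣ coef f 0) →
    Divisible ℓ (f ⊗ g) → Divisible ℓ g
  divisible-cofactor pr f []      ℓ∤f₀ ℓ∣fg n = divides 0ℤ refl
  divisible-cofactor pr f (b ∷ g) ℓ∤f₀ ℓ∣fg =
    λ { zero → ℓ∣b
      ; (suc n) → divisible-cofactor pr f g ℓ∤f₀
          (λ m → ℤ∣.∣m+n∣m⇒∣n (subst (_ ∣_) (coef-⊗-∷ f b g m) (ℓ∣fg (suc m)))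
                   (ℤ∣.∣m⇒∣m*n (coef f (suc m)) ℓ∣b)) n }
    where
    ℓ∣b : _ ∣ b
    ℓ∣b with euclid pr (coef f 0) b (subst (_ ∣_) (coef-⊗-zero f (b ∷ g)) (ℓ∣fg 0))
    ... | inj₁ ℓ∣f₀ = contradiction ℓ∣f₀ ℓ∤f₀
    ... | inj₂ ℓ∣b  = ℓ∣b

  -- A prime of ℤ stays prime in ℤ[x]: low coefficients of f divisible by ℓ are stripped off until
  -- one is not, and then `divisible-cofactor` applies.
  divisible-⊗ : ∀ {ℓ} → Prime ℓ → ∀ f g → Divisible ℓ (f ⊗ g) → Divisible ℓ f ⊎ Divisible ℓ g
  divisible-⊗ pr []      g ℓ∣fg = inj₁ λ _ → divides 0ℤ refl
  divisible-⊗ {ℓ} pr (a ∷ f) g ℓ∣fg with + ℓ ℤ∣.∣? a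
  ... | no  ℓ∤a = inj₂ (divisible-cofactor pr (a ∷ f) g ℓ∤a ℓ∣fg)
  ... | yes ℓ∣a with divisible-⊗ pr f g
        (λ n → ℤ∣.∣m+n∣m⇒∣n (subst (_ ∣_) (coef-⊗-suc a f g n) (ℓ∣fg (suc n)))
                 (ℤ∣.∣m⇒∣m*n (coef g (suc n)) ℓ∣a))
  ...   | inj₁ ℓ∣f = inj₁ λ { zero → ℓ∣a ; (suc n) → ℓ∣f n }
  ...   | inj₂ ℓ∣g = inj₂ ℓ∣g

  quotient : ∀ ℓ f → Divisible ℓ f → ∃ λ f′ → f ≈ₚ + ℓ ⊙ f′
  quotient ℓ []      ℓ∣f = [] , λ _ → refl
  quotient ℓ (a ∷ f) ℓ∣f with ℓ∣f 0 | quotient ℓ f (λ n → ℓ∣f (suc n))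
  ... | divides q a≡qℓ | f′ , f≈ =
    q ∷ f′ , λ { zero → trans a≡qℓ (ℤP.*-comm q (+ ℓ)) ; (suc n) → f≈ n }

  ⊙-cancel : ∀ c .{{_ : ℤ.NonZero c}} {f g} → c ⊙ f ≈ₚ c ⊙ g → f ≈ₚ g
  ⊙-cancel c {f} {g} cf≈cg n = ℤP.*-cancelˡ-≡ c (coef f n) (coef g n)
    (trans (sym (coef-⊙ c f n)) (trans (cf≈cg n) (coef-⊙ c g n)))

  PrimitiveFactorisation : List ℤ → List ℤ → Set
  PrimitiveFactorisation f P = ∃ λ f′ → ∃ λ h′ → ∃ λ c → f ≈ₚ c ⊙ f′ × f′ ⊗ h′ ≈ₚ P

  -- The common denominator is removed one prime at a time; each prime divides f or h as a whole.
  -- Only the primes taken out of f are collected in the scalar c, since h matters only through its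
  -- existence.
  gauss : ∀ {ns} → All Prime ns → ∀ f h P → f ⊗ h ≈ₚ + product ns ⊙ P → PrimitiveFactorisation f P
  gauss [] f h P fh≈P =
    f , h , 1ℤ , (λ n → sym (1⊙ f n)) , λ n → trans (fh≈P n) (1⊙ P n)
  gauss {ℓ ∷ ns} (pr ∷ prs) f h P fh≈NP with divisible-⊗ pr f h ℓ∣fh
    where
    ℓ∣fh : Divisible ℓ (f ⊗ h)
    ℓ∣fh n = divides (+ product ns ℤ.* coef P n)
      (trans (fh≈NP n) (trans (coef-⊙ (+ (ℓ ℕ.* product ns)) P n)
        (trans (cong (ℤ._* coef P n) (ℤP.pos-* ℓ (product ns))) (rearrange (+ ℓ) _ _))))
      where
      rearrange : ∀ x y z → x ℤ.* y ℤ.* z ≡ y ℤ.* z ℤ.* x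
      rearrange = solve-∀
  ... | inj₁ ℓ∣f with quotient ℓ f ℓ∣f
  ...   | f₁ , f≈ℓf₁ with gauss prs f₁ h P (⊙-cancel (+ ℓ) {{prime⇒nonZero pr}} {f₁ ⊗ h} {+ product ns ⊙ P} λ n →
            trans (sym (⊙-⊗ (+ ℓ) f₁ h n))
              (trans (sym (⊗-congˡ {f} {+ ℓ ⊙ f₁} h f≈ℓf₁ n))
                (trans (fh≈NP n) (trans (cong (λ c → coef (c ⊙ P) n) (ℤP.pos-* ℓ (product ns)))
                  (sym (⊙-⊙ (+ ℓ) (+ product ns) P n))))))
  ...     | f′ , h′ , c , f₁≈cf′ , f′h′≈P =
    f′ , h′ , + ℓ ℤ.* c ,
    (λ n → trans (f≈ℓf₁ n) (trans (⊙-cong (+ ℓ) {f₁} {c ⊙ f′} f₁≈cf′ n) (⊙-⊙ (+ ℓ) c f′ n))) , f′h′≈P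
  gauss {ℓ ∷ ns} (pr ∷ prs) f h P fh≈NP
      | inj₂ ℓ∣h with quotient ℓ h ℓ∣h
  ...   | h₁ , h≈ℓh₁ = gauss prs f h₁ P (⊙-cancel (+ ℓ) {{prime⇒nonZero pr}} {f ⊗ h₁} {+ product ns ⊙ P} λ n →
            trans (sym (⊗-⊙ (+ ℓ) f h₁ n))
              (trans (sym (⊗-congʳ f {h} {+ ℓ ⊙ h₁} h≈ℓh₁ n))
                (trans (fh≈NP n) (trans (cong (λ c → coef (c ⊙ P) n) (ℤP.pos-* ℓ (product ns)))
                  (sym (⊙-⊙ (+ ℓ) (+ product ns) P n))))))

  unit-factor : ∀ i j → i ℤ.* j ≡ 1ℤ → i ≡ 1ℤ ⊎ i ≡ ℤ.- 1ℤ
  unit-factor i j ij≡1 = by-abs i (ℕP.m*n≡1⇒m≡1 ℤ.∣ i ∣ ℤ.∣ j ∣ (trans (sym (ℤP.abs-* i j)) (cong ℤ.∣_∣ ij≡1)))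
    where
    by-abs : ∀ i → ℤ.∣ i ∣ ≡ 1 → i ≡ 1ℤ ⊎ i ≡ ℤ.- 1ℤ
    by-abs (+ n)    eq = inj₁ (cong +_ eq)
    by-abs -[1+ n ] eq = inj₂ (cong (λ k → ℤ.- (+ k)) eq)

  -- The constant terms of the two factors multiply to 1, so both are 1 or both are -1; in the
  -- second case both factors change sign.
  normalise-sign : ∀ {f P} → coef P 0 ≡ 1ℤ → PrimitiveFactorisation f P →
    ∃ λ f′ → ∃ λ h′ → ∃ λ c → f ≈ₚ c ⊙ f′ × f′ ⊗ h′ ≈ₚ P × coef f′ 0 ≡ 1ℤ
  normalise-sign {f} {P} P₀≡1 (f′ , h′ , c , f≈cf′ , f′h′≈P)
    with unit-factor (coef f′ 0) (coef h′ 0) (trans (sym (coef-⊗-zero f′ h′)) (trans (f′h′≈P 0) P₀≡1))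
  ... | inj₁ f′₀≡1  = f′ , h′ , c , f≈cf′ , f′h′≈P , f′₀≡1
  ... | inj₂ f′₀≡-1 =
    ε ⊙ f′ , ε ⊙ h′ , c ℤ.* ε ,
    (λ n → trans (f≈cf′ n) (trans (⊙-cong c {f′} {ε ⊙ (ε ⊙ f′)} (λ m → sym (twice f′ m)) n) (⊙-⊙ c ε (ε ⊙ f′) n))) ,
    (λ n → trans (⊙-⊗ ε f′ (ε ⊙ h′) n)
      (trans (⊙-cong ε {f′ ⊗ (ε ⊙ h′)} {ε ⊙ (f′ ⊗ h′)} (⊗-⊙ ε f′ h′) n)
        (trans (twice (f′ ⊗ h′) n) (f′h′≈P n)))) ,
    trans (coef-⊙ ε f′ 0) (cong (ε ℤ.*_) f′₀≡-1)
    where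
    ε = ℤ.- 1ℤ
    twice : ∀ g → ε ⊙ (ε ⊙ g) ≈ₚ g
    twice g n = trans (⊙-⊙ ε ε g n) (1⊙ g n)

-- The embedding of ℤ[x] into ℚ[x].

fromℤ-injective : ∀ {i j} → fromℤ i ≡ fromℤ j → i ≡ j
fromℤ-injective refl = refl

-- `fromℤ` has denominator 1 by construction, whereas addition in ℚ normalises its result; the
-- comparison is therefore made between unnormalised fractions.
fromℤ-+ : ∀ i j → fromℤ (i ℤ.+ j) ≡ fromℤ i ℚ.+ fromℤ j
fromℤ-+ i j = ℚP.toℚᵘ-injective
  (ℚᵘP.≃-trans (ℚᵘ.*≡* (numerators i j)) (ℚᵘP.≃-sym (ℚP.toℚᵘ-homo-+ (fromℤ i) (fromℤ j))))
  where
  numerators : ∀ i j → (i ℤ.+ j) ℤ.* 1ℤ ≡ (i ℤ.* 1ℤ ℤ.+ j ℤ.* 1ℤ) ℤ.* 1ℤ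
  numerators = solve-∀

fromℤ-* : ∀ i j → fromℤ (i ℤ.* j) ≡ fromℤ i ℚ.* fromℤ j
fromℤ-* i j = ℚP.toℚᵘ-injective
  (ℚᵘP.≃-trans (ℚᵘ.*≡* refl) (ℚᵘP.≃-sym (ℚP.toℚᵘ-homo-* (fromℤ i) (fromℤ j))))

denominator-* : ∀ q → fromℤ (ℚ.↥ q) ≡ fromℤ (ℚ.↧ q) ℚ.* q
denominator-* q@(mkℚ i d-1 _) = ℚP.toℚᵘ-injective
  (ℚᵘP.≃-trans (ℚᵘ.*≡* (trans (cong (λ k → i ℤ.* + k) (ℕP.*-identityˡ (suc d-1))) (numerators i (+ suc d-1))))
    (ℚᵘP.≃-sym (ℚP.toℚᵘ-homo-* (fromℤ (+ suc d-1)) q)))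
  where
  numerators : ∀ i d → i ℤ.* d ≡ d ℤ.* i ℤ.* 1ℤ
  numerators = solve-∀

module ℤ→ℚ = BaseChange ℤP.+-*-isCommutativeRing ℚP.+-*-isCommutativeRing fromℤ refl fromℤ-+ fromℤ-*

toℚ[x] : List ℤ → List ℚ
toℚ[x] = map fromℤ

toℚ[x]-injective : ∀ f g → toℚ[x] f ℚ[x].≈ₚ toℚ[x] g → f ℤ[x].≈ₚ g
toℚ[x]-injective f g f≈g n =
  fromℤ-injective (trans (sym (ℤ→ℚ.coef-map f n)) (trans (f≈g n) (ℤ→ℚ.coef-map g n)))

clear-denominators : ∀ g → ∃ λ N → ∃ λ G → ℕ.NonZero N × toℚ[x] G ℚ[x].≈ₚ fromℤ (+ N) ℚ[x].⊙ g
clear-denominators []      = 1 , [] , _ , λ _ → refl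
clear-denominators (a ∷ g) with clear-denominators g
... | N , G , N≢0 , G≈Ng =
  d ℕ.* N , (ℚ.↥ a ℤ.* + N) ∷ (+ d ℤ[x].⊙ G) , ℕP.m*n≢0 d N {{_}} {{N≢0}} ,
  λ { zero → constant ; (suc n) → higher n }
  where
  open ≡-Reasoning
  d = ℚ.↧ₙ a
  dN≡ : fromℤ (+ (d ℕ.* N)) ≡ fromℤ (+ d) ℚ.* fromℤ (+ N)
  dN≡ = trans (cong fromℤ (ℤP.pos-* d N)) (fromℤ-* (+ d) (+ N))
  constant : fromℤ (ℚ.↥ a ℤ.* + N) ≡ fromℤ (+ (d ℕ.* N)) ℚ.* a
  constant = begin
    fromℤ (ℚ.↥ a ℤ.* + N)                   ≡⟨ fromℤ-* (ℚ.↥ a) (+ N) ⟩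
    fromℤ (ℚ.↥ a) ℚ.* fromℤ (+ N)           ≡⟨ cong (ℚ._* fromℤ (+ N)) (denominator-* a) ⟩
    fromℤ (+ d) ℚ.* a ℚ.* fromℤ (+ N)       ≡⟨ ℚP.*-assoc (fromℤ (+ d)) a _ ⟩
    fromℤ (+ d) ℚ.* (a ℚ.* fromℤ (+ N))     ≡⟨ cong (fromℤ (+ d) ℚ.*_) (ℚP.*-comm a _) ⟩
    fromℤ (+ d) ℚ.* (fromℤ (+ N) ℚ.* a)     ≡⟨ ℚP.*-assoc (fromℤ (+ d)) (fromℤ (+ N)) a ⟨
    fromℤ (+ d) ℚ.* fromℤ (+ N) ℚ.* a       ≡⟨ cong (ℚ._* a) dN≡ ⟨
    fromℤ (+ (d ℕ.* N)) ℚ.* a               ∎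
  higher : ∀ n → ℚ[x].coef (toℚ[x] (+ d ℤ[x].⊙ G)) n ≡ ℚ[x].coef (fromℤ (+ (d ℕ.* N)) ℚ[x].⊙ g) n
  higher n = begin
    ℚ[x].coef (toℚ[x] (+ d ℤ[x].⊙ G)) n                    ≡⟨ cong (λ f → ℚ[x].coef f n) (ℤ→ℚ.map-⊙ (+ d) G) ⟩
    ℚ[x].coef (fromℤ (+ d) ℚ[x].⊙ toℚ[x] G) n              ≡⟨ ℚ[x].⊙-cong (fromℤ (+ d)) {toℚ[x] G} {fromℤ (+ N) ℚ[x].⊙ g} G≈Ng n ⟩
    ℚ[x].coef (fromℤ (+ d) ℚ[x].⊙ (fromℤ (+ N) ℚ[x].⊙ g)) n ≡⟨ ℚ[x].⊙-⊙ (fromℤ (+ d)) (fromℤ (+ N)) g n ⟩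
    ℚ[x].coef ((fromℤ (+ d) ℚ.* fromℤ (+ N)) ℚ[x].⊙ g) n   ≡⟨ cong (λ c → ℚ[x].coef (c ℚ[x].⊙ g) n) dN≡ ⟨
    ℚ[x].coef (fromℤ (+ (d ℕ.* N)) ℚ[x].⊙ g) n             ∎

-- Positivity of factors on the nonnegative half-line.

fromℤ-mono-≤ : ∀ {i j} → i ℤ.≤ j → fromℤ i ℚ.≤ fromℤ j
fromℤ-mono-≤ i≤j = *≤* (ℤP.*-monoʳ-≤-nonNeg 1ℤ i≤j)

fromℤ≥0 : ∀ n → 0ℚ ℚ.≤ fromℤ (+ n)
fromℤ≥0 n = fromℤ-mono-≤ {0ℤ} {+ n} (ℤ.+≤+ ℕ.z≤n)

module _ where
  open import Data.Rational using (_+_; _*_; _-_; -_; _≤_; _<_; ∣_∣)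
  open ℚ[x] using (eval)
  open ℚP.≤-Reasoning
  open +-*-Solver using (solve; _:=_; _:+_; _:*_; _:-_; con)

  *-mono-nonNeg : ∀ {p q r s} → 0ℚ ≤ p → 0ℚ ≤ s → p ≤ q → r ≤ s → p * r ≤ q * s
  *-mono-nonNeg {p} {q} {r} {s} 0≤p 0≤s p≤q r≤s = begin
    p * r ≤⟨ ℚP.*-monoˡ-≤-nonNeg p {{ℚ.nonNegative 0≤p}} r≤s ⟩
    p * s ≤⟨ ℚP.*-monoʳ-≤-nonNeg s {{ℚ.nonNegative 0≤s}} p≤q ⟩
    q * s ∎

  *-nonNeg : ∀ {p q} → 0ℚ ≤ p → 0ℚ ≤ q → 0ℚ ≤ p * q
  *-nonNeg {p} {q} 0≤p 0≤q = begin
    0ℚ      ≡⟨ ℚP.*-zeroʳ p ⟨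
    p * 0ℚ  ≤⟨ ℚP.*-monoˡ-≤-nonNeg p {{ℚ.nonNegative 0≤p}} 0≤q ⟩
    p * q   ∎

  p≤∣p∣ : ∀ p → p ≤ ∣ p ∣
  p≤∣p∣ (mkℚ (+ n) _ _)     = ℚP.≤-refl
  p≤∣p∣ (mkℚ -[1+ n ] _ _) = *≤* ℤ.-≤+

  module _ {M : ℚ} (0≤M : 0ℚ ≤ M) where

    -- Bounds for |f| and for the difference quotients of f on |x| ≤ M. The second follows Horner's
    -- rule through x u - y v = (x - y) u + y (u - v).
    bound lipschitz : List ℚ → ℚ
    bound []      = 0ℚ
    bound (a ∷ f) = ∣ a ∣ + M * bound f
    lipschitz []      = 0ℚ
    lipschitz (a ∷ f) = bound f + M * lipschitz f

    bound≥0 : ∀ f → 0ℚ ≤ bound f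
    bound≥0 []      = ℚP.≤-refl
    bound≥0 (a ∷ f) = ℚP.+-mono-≤ (ℚP.0≤∣p∣ a) (*-nonNeg 0≤M (bound≥0 f))

    lipschitz≥0 : ∀ f → 0ℚ ≤ lipschitz f
    lipschitz≥0 []      = ℚP.≤-refl
    lipschitz≥0 (a ∷ f) = ℚP.+-mono-≤ (bound≥0 f) (*-nonNeg 0≤M (lipschitz≥0 f))

    ∣eval∣≤bound : ∀ f {x} → ∣ x ∣ ≤ M → ∣ eval x f ∣ ≤ bound f
    ∣eval∣≤bound []      ∣x∣≤M = ℚP.≤-refl
    ∣eval∣≤bound (a ∷ f) {x} ∣x∣≤M = begin
      ∣ a + x * eval x f ∣           ≤⟨ ℚP.∣p+q∣≤∣p∣+∣q∣ a _ ⟩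
      ∣ a ∣ + ∣ x * eval x f ∣       ≡⟨ cong (λ u → ∣ a ∣ + u) (ℚP.∣p*q∣≡∣p∣*∣q∣ x _) ⟩
      ∣ a ∣ + ∣ x ∣ * ∣ eval x f ∣   ≤⟨ ℚP.+-monoʳ-≤ ∣ a ∣ (*-mono-nonNeg (ℚP.0≤∣p∣ x) (bound≥0 f) ∣x∣≤M (∣eval∣≤bound f ∣x∣≤M)) ⟩
      ∣ a ∣ + M * bound f            ∎

    eval-lipschitz : ∀ f {x y} → ∣ x ∣ ≤ M → ∣ y ∣ ≤ M →
      ∣ eval x f - eval y f ∣ ≤ ∣ x - y ∣ * lipschitz f
    eval-lipschitz [] {x} {y} _ _ = begin
      ∣ 0ℚ - 0ℚ ∣      ≡⟨⟩
      0ℚ               ≡⟨ ℚP.*-zeroʳ ∣ x - y ∣ ⟨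
      ∣ x - y ∣ * 0ℚ   ∎
    eval-lipschitz (a ∷ f) {x} {y} ∣x∣≤M ∣y∣≤M = begin
      ∣ (a + x * u) - (a + y * v) ∣
        ≡⟨ cong ∣_∣ (solve 5 (λ a x y u v → (a :+ x :* u) :- (a :+ y :* v) := (x :- y) :* u :+ y :* (u :- v)) refl a x y u v) ⟩
      ∣ (x - y) * u + y * (u - v) ∣
        ≤⟨ ℚP.∣p+q∣≤∣p∣+∣q∣ ((x - y) * u) (y * (u - v)) ⟩
      ∣ (x - y) * u ∣ + ∣ y * (u - v) ∣
        ≡⟨ cong₂ _+_ (ℚP.∣p*q∣≡∣p∣*∣q∣ (x - y) u) (ℚP.∣p*q∣≡∣p∣*∣q∣ y (u - v)) ⟩
      ∣ x - y ∣ * ∣ u ∣ + ∣ y ∣ * ∣ u - v ∣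
        ≤⟨ ℚP.+-mono-≤
             (*-mono-nonNeg (ℚP.0≤∣p∣ (x - y)) (bound≥0 f) ℚP.≤-refl (∣eval∣≤bound f ∣x∣≤M))
             (*-mono-nonNeg (ℚP.0≤∣p∣ y) (*-nonNeg (ℚP.0≤∣p∣ (x - y)) (lipschitz≥0 f)) ∣y∣≤M (eval-lipschitz f ∣x∣≤M ∣y∣≤M)) ⟩
      ∣ x - y ∣ * bound f + M * (∣ x - y ∣ * lipschitz f)
        ≡⟨ solve 4 (λ d b m l → d :* b :+ m :* (d :* l) := d :* (b :+ m :* l)) refl ∣ x - y ∣ (bound f) M (lipschitz f) ⟩
      ∣ x - y ∣ * (bound f + M * lipschitz f) ∎
      where
      u = eval x f
      v = eval y f

    -- f(x) h(x) ≥ 1 keeps f(x) at least 1 / bound h, so that f cannot change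
    -- sign within a distance 1 / (lipschitz f · bound h).
    positive-step : ∀ f h {x y} → ∣ x ∣ ≤ M → ∣ y ∣ ≤ M →
      1ℚ ≤ eval x f * eval x h → ∣ x - y ∣ * (lipschitz f * bound h) < 1ℚ →
      0ℚ < eval x f → 0ℚ < eval y f
    positive-step f h {x} {y} ∣x∣≤M ∣y∣≤M 1≤fh close 0<fx = ℚP.≰⇒> λ fy≤0 →
      ℚP.<-irrefl refl (begin-strict
        1ℚ                                    ≤⟨ 1≤fh ⟩
        u * eval x h                          ≤⟨ ℚP.*-monoˡ-≤-nonNeg u {{ℚ.nonNegative (ℚP.<⇒≤ 0<fx)}}
                                                    (ℚP.≤-trans (p≤∣p∣ _) (∣eval∣≤bound h ∣x∣≤M)) ⟩
        u * B                                 ≤⟨ ℚP.*-monoʳ-≤-nonNeg B {{ℚ.nonNegative (bound≥0 h)}} (u≤ fy≤0) ⟩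
        ∣ x - y ∣ * lipschitz f * B           ≡⟨ ℚP.*-assoc ∣ x - y ∣ (lipschitz f) B ⟩
        ∣ x - y ∣ * (lipschitz f * B)         <⟨ close ⟩
        1ℚ                                    ∎)
      where
      u = eval x f
      B = bound h
      u≤ : eval y f ≤ 0ℚ → u ≤ ∣ x - y ∣ * lipschitz f
      u≤ fy≤0 = begin
        u                              ≡⟨ ℚP.+-identityʳ u ⟨
        u + 0ℚ                         ≤⟨ ℚP.+-monoʳ-≤ u (ℚP.neg-antimono-≤ fy≤0) ⟩
        u - eval y f                   ≤⟨ p≤∣p∣ _ ⟩
        ∣ u - eval y f ∣               ≤⟨ eval-lipschitz f ∣x∣≤M ∣y∣≤M ⟩
        ∣ x - y ∣ * lipschitz f        ∎

  archimedean : ∀ q → ∃ λ n → q < fromℤ (+ suc n)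
  archimedean (mkℚ (+ k) d-1 _) = k , *<* (subst₂ ℤ._<_ (sym (ℤP.*-identityʳ (+ k))) (ℤP.pos-* (suc k) (suc d-1))
    (ℤ.+<+ (ℕP.≤-trans (ℕP.n<1+n k) (ℕP.m≤m*n (suc k) (suc d-1)))))
  archimedean (mkℚ -[1+ k ] d-1 _) = 0 , *<* ℤ.-<+

  -- A discrete substitute for the intermediate value theorem: equally spaced points from 0 to M, so
  -- close together that `positive-step` carries the sign of f from each to the next.
  positive-persists : ∀ f h {M} → 0ℚ ≤ M →
    (∀ {x} → 0ℚ ≤ x → 1ℚ ≤ eval x f * eval x h) →
    0ℚ < eval 0ℚ f → 0ℚ < eval M f
  positive-persists f h {M} 0≤M 1≤fh 0<f₀ =
    subst (λ x → 0ℚ < eval x f) node-N (along (suc n) ℕP.≤-refl)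
    where
    L = lipschitz 0≤M f * bound 0≤M h
    -- The number of steps N = n + 1 exceeds M L, so the step length δ = M / N satisfies δ L < 1, as
    -- `positive-step` demands.
    n = proj₁ (archimedean (M * L))
    N = fromℤ (+ suc n)
    δ = M * 1/ N

    0≤δ : 0ℚ ≤ δ
    0≤δ = *-nonNeg {M} {1/ N} 0≤M (*≤* (ℤ.+≤+ ℕ.z≤n))

    node : ℕ → ℚ
    node i = fromℤ (+ i) * δ

    node-N : node (suc n) ≡ M
    node-N = trans (solve 3 (λ N M r → N :* (M :* r) := M :* (N :* r)) refl N M (1/ N))
      (trans (cong (M *_) (ℚP.*-inverseʳ N)) (ℚP.*-identityʳ M))

    node≥0 : ∀ i → 0ℚ ≤ node i
    node≥0 i = *-nonNeg {fromℤ (+ i)} (fromℤ≥0 i) 0≤δ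

    node≤M : ∀ {i} → i ℕ.≤ suc n → ∣ node i ∣ ≤ M
    node≤M {i} i≤N = begin
      ∣ node i ∣    ≡⟨ ℚP.0≤p⇒∣p∣≡p (node≥0 i) ⟩
      node i        ≤⟨ ℚP.*-monoʳ-≤-nonNeg δ {{ℚ.nonNegative 0≤δ}} {fromℤ (+ i)} {N} (fromℤ-mono-≤ {+ i} {+ suc n} (ℤ.+≤+ i≤N)) ⟩
      node (suc n)  ≡⟨ node-N ⟩
      M             ∎

    spacing : ∀ i → ∣ node i - node (suc i) ∣ ≡ δ
    spacing i = begin-equality
      ∣ node i - node (suc i) ∣          ≡⟨ cong (λ k → ∣ node i - k * δ ∣) (fromℤ-+ 1ℤ (+ i)) ⟩
      ∣ node i - (1ℚ + fromℤ (+ i)) * δ ∣ ≡⟨ cong ∣_∣ (solve 2 (λ j d → j :* d :- (con 1ℚ :+ j) :* d := con 0ℚ :- d) refl (fromℤ (+ i)) δ) ⟩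
      ∣ 0ℚ - δ ∣                         ≡⟨ cong ∣_∣ (ℚP.+-identityˡ (- δ)) ⟩
      ∣ - δ ∣                            ≡⟨ ℚP.∣-p∣≡∣p∣ δ ⟩
      ∣ δ ∣                              ≡⟨ ℚP.0≤p⇒∣p∣≡p 0≤δ ⟩
      δ                                  ∎

    close : ∀ i → ∣ node i - node (suc i) ∣ * L < 1ℚ
    close i = begin-strict
      ∣ node i - node (suc i) ∣ * L  ≡⟨ cong (_* L) (spacing i) ⟩
      M * 1/ N * L                   ≡⟨ solve 3 (λ m r l → m :* r :* l := m :* l :* r) refl M (1/ N) L ⟩
      M * L * 1/ N                   <⟨ ℚP.*-monoˡ-<-pos (1/ N) (proj₂ (archimedean (M * L))) ⟩
      N * 1/ N                       ≡⟨ ℚP.*-inverseʳ N ⟩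
      1ℚ                             ∎

    along : ∀ i → i ℕ.≤ suc n → 0ℚ < eval (node i) f
    along zero    _   = subst (λ x → 0ℚ < eval x f) (sym (ℚP.*-zeroˡ δ)) 0<f₀
    along (suc i) i<N = positive-step 0≤M f h (node≤M (ℕP.<⇒≤ i<N)) (node≤M i<N)
      (1≤fh (node≥0 i)) (close i) (along i (ℕP.<⇒≤ i<N))

  eval-nonNegative : ∀ f → NonNegative f → ∀ {x} → 0ℚ ≤ x → 0ℚ ≤ eval x (toℚ[x] f)
  eval-nonNegative []      f≥0 0≤x = ℚP.≤-refl
  eval-nonNegative (a ∷ f) f≥0 0≤x =
    ℚP.+-mono-≤ (fromℤ-mono-≤ (f≥0 0)) (*-nonNeg 0≤x (eval-nonNegative f (λ n → f≥0 (suc n)) 0≤x))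

  eval≥1 : ∀ f → NonNegative f → ℤ[x].coef f 0 ≡ 1ℤ → ∀ {x} → 0ℚ ≤ x → 1ℚ ≤ eval x (toℚ[x] f)
  eval≥1 (a ∷ f) f≥0 refl {x} 0≤x = begin
    1ℚ                         ≡⟨ ℚP.+-identityʳ 1ℚ ⟨
    1ℚ + 0ℚ                    ≤⟨ ℚP.+-monoʳ-≤ 1ℚ (*-nonNeg 0≤x (eval-nonNegative f (λ n → f≥0 (suc n)) 0≤x)) ⟩
    1ℚ + x * eval x (toℚ[x] f) ∎

eval-fromℤ : ∀ x f → ℚ[x].eval (fromℤ x) (toℚ[x] f) ≡ fromℤ (ℤ[x].eval x f)
eval-fromℤ x []      = refl
eval-fromℤ x (a ∷ f) = begin
  fromℤ a ℚ.+ fromℤ x ℚ.* ℚ[x].eval (fromℤ x) (toℚ[x] f)  ≡⟨ cong (λ u → fromℤ a ℚ.+ fromℤ x ℚ.* u) (eval-fromℤ x f) ⟩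
  fromℤ a ℚ.+ fromℤ x ℚ.* fromℤ (ℤ[x].eval x f)           ≡⟨ cong (λ u → fromℤ a ℚ.+ u) (fromℤ-* x _) ⟨
  fromℤ a ℚ.+ fromℤ (x ℤ.* ℤ[x].eval x f)                 ≡⟨ fromℤ-+ a _ ⟨
  fromℤ (a ℤ.+ x ℤ.* ℤ[x].eval x f)                       ∎
  where open ≡-Reasoning

factor-positive : ∀ {f h P} → f ℤ[x].⊗ h ℤ[x].≈ₚ P → NonNegative P → ℤ[x].coef P 0 ≡ 1ℤ →
  ℤ[x].coef f 0 ≡ 1ℤ → ∀ m → 0ℤ ℤ.< ℤ[x].eval (+ m) f
factor-positive {f} {h} {P} fh≈P P≥0 P₀≡1 f₀≡1 m =
  fromℤ-cancel-< (subst (0ℚ ℚ.<_) (eval-fromℤ (+ m) f)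
    (positive-persists (toℚ[x] f) (toℚ[x] h) (fromℤ≥0 m) 1≤fh 0<f₀))
  where
  fromℤ-cancel-< : ∀ {i} → 0ℚ ℚ.< fromℤ i → 0ℤ ℤ.< i
  fromℤ-cancel-< {i} (*<* 0<i) = subst (0ℤ ℤ.<_) (ℤP.*-identityʳ i) 0<i

  1≤fh : ∀ {x} → 0ℚ ℚ.≤ x → 1ℚ ℚ.≤ ℚ[x].eval x (toℚ[x] f) ℚ.* ℚ[x].eval x (toℚ[x] h)
  1≤fh {x} 0≤x = subst (1ℚ ℚ.≤_)
    (trans (sym (ℚ[x].eval-cong x {toℚ[x] (f ℤ[x].⊗ h)} {toℚ[x] P} (ℤ→ℚ.map-≈ {f ℤ[x].⊗ h} {P} fh≈P)))
      (trans (cong (ℚ[x].eval x) (ℤ→ℚ.map-⊗ f h)) (ℚ[x].eval-⊗ x (toℚ[x] f) (toℚ[x] h))))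
    (eval≥1 P P≥0 P₀≡1 0≤x)

  eval-0 : ∀ f → ℚ[x].eval 0ℚ f ≡ ℚ[x].coef f 0
  eval-0 []      = refl
  eval-0 (a ∷ f) = trans (cong (λ u → a ℚ.+ u) (ℚP.*-zeroˡ (ℚ[x].eval 0ℚ f))) (ℚP.+-identityʳ a)

  0<f₀ : 0ℚ ℚ.< ℚ[x].eval 0ℚ (toℚ[x] f)
  0<f₀ = subst (0ℚ ℚ.<_) (sym (trans (eval-0 (toℚ[x] f)) (trans (ℤ→ℚ.coef-map f 0) (cong fromℤ f₀≡1))))
    (*<* (ℤ.+<+ (ℕ.s≤s ℕ.z≤n)))

-- Comparison with the definitions of the statement.

coeff≡coef : ∀ f n → coeff f n ≡ ℚ[x].coef f n
coeff≡coef []      n       = refl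
coeff≡coef (a ∷ f) zero    = refl
coeff≡coef (a ∷ f) (suc n) = coeff≡coef f n

+P≡⊕ : ∀ f g → f +P g ≡ f ℚ[x].⊕ g
+P≡⊕ []      g       = refl
+P≡⊕ (a ∷ f) []      = refl
+P≡⊕ (a ∷ f) (b ∷ g) = cong (_ ∷_) (+P≡⊕ f g)

*P≡⊗ : ∀ f g → f *P g ≡ f ℚ[x].⊗ g
*P≡⊗ []      g = refl
*P≡⊗ (a ∷ f) g = trans (+P≡⊕ (a ·P g) (0ℚ ∷ (f *P g))) (cong (λ h → (a ·P g) ℚ[x].⊕ (0ℚ ∷ h)) (*P≡⊗ f g))

≈P⇒≈ₚ : ∀ {f g} → f ≈P g → f ℚ[x].≈ₚ g
≈P⇒≈ₚ {f} {g} f≈g n = trans (sym (coeff≡coef f n)) (trans (f≈g n) (coeff≡coef g n))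

≈ₚ⇒≈P : ∀ {f g} → f ℚ[x].≈ₚ g → f ≈P g
≈ₚ⇒≈P {f} {g} f≈g n = trans (coeff≡coef f n) (trans (f≈g n) (sym (coeff≡coef g n)))

module _ where
  open ℚ[x]
  open ≡-Reasoning

  coef-negP : ∀ f n → coef (negP f) n ≡ ℚ.- coef f n
  coef-negP []      n       = refl
  coef-negP (a ∷ f) zero    = refl
  coef-negP (a ∷ f) (suc n) = coef-negP f n

  coef-minusP : ∀ f g n → coef (f -P g) n ≡ coef f n ℚ.- coef g n
  coef-minusP f g n = trans (cong (λ h → coef h n) (+P≡⊕ f (negP g)))
    (trans (coef-⊕ f (negP g) n) (cong (λ u → coef f n ℚ.+ u) (coef-negP g n)))

  coef-qInt-suc : ∀ k r n → coef (qInt (suc k) *P r) n ≡ coef r n ℚ.+ coef (0ℚ ∷ (qInt k *P r)) n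
  coef-qInt-suc k r n = trans (cong (λ h → coef h n) (+P≡⊕ (1ℚ ·P r) (0ℚ ∷ (qInt k *P r))))
    (trans (coef-⊕ (1ℚ ⊙ r) (0ℚ ∷ (qInt k *P r)) n) (cong (ℚ._+ coef (0ℚ ∷ (qInt k *P r)) n) (1⊙ r n)))

  -- Induction on k through [k + 2] r - q^(k+1) s = r + q ([k + 1] r - q^k s), which is the Horner
  -- step of `convergent`.
  convergent-correct : ∀ k r s R S → r ≈ₚ toℚ[x] R → s ≈ₚ toℚ[x] S →
    (qInt (suc k) *P r) -P shiftP k s ≈ₚ toℚ[x] (convergent k R S)
  convergent-correct zero r s R S r≈R s≈S n = begin
    coef ((qInt 1 *P r) -P s) n
      ≡⟨ coef-minusP (qInt 1 *P r) s n ⟩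
    coef (qInt 1 *P r) n ℚ.- coef s n
      ≡⟨ cong (ℚ._- coef s n) (trans (coef-qInt-suc 0 r n)
           (trans (cong (λ u → coef r n ℚ.+ u) (shifted-zero n)) (ℚP.+-identityʳ (coef r n)))) ⟩
    coef r n ℚ.- coef s n
      ≡⟨ cong₂ ℚ._-_ (trans (r≈R n) (ℤ→ℚ.coef-map R n)) (trans (s≈S n) (ℤ→ℚ.coef-map S n)) ⟩
    fromℤ (ℤ[x].coef R n) ℚ.- fromℤ (ℤ[x].coef S n)
      ≡⟨ cong (λ u → fromℤ (ℤ[x].coef R n) ℚ.+ u) (negate (fromℤ (ℤ[x].coef S n))) ⟩
    fromℤ (ℤ[x].coef R n) ℚ.+ fromℤ (ℤ.- 1ℤ) ℚ.* fromℤ (ℤ[x].coef S n)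
      ≡⟨ cong (λ u → fromℤ (ℤ[x].coef R n) ℚ.+ u) (fromℤ-* (ℤ.- 1ℤ) (ℤ[x].coef S n)) ⟨
    fromℤ (ℤ[x].coef R n) ℚ.+ fromℤ (ℤ.- 1ℤ ℤ.* ℤ[x].coef S n)
      ≡⟨ fromℤ-+ (ℤ[x].coef R n) _ ⟨
    fromℤ (ℤ[x].coef R n ℤ.+ ℤ.- 1ℤ ℤ.* ℤ[x].coef S n)
      ≡⟨ trans (ℤ→ℚ.coef-map (convergent 0 R S) n) (cong fromℤ (coef-turn R S n)) ⟨
    coef (toℚ[x] (convergent 0 R S)) n ∎
    where
    shifted-zero : ∀ n → coef (0ℚ ∷ []) n ≡ 0ℚ
    shifted-zero zero    = refl
    shifted-zero (suc n) = refl
    negate : ∀ q → ℚ.- q ≡ fromℤ (ℤ.- 1ℤ) ℚ.* q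
    negate q = trans (cong ℚ.-_ (sym (ℚP.*-identityˡ q))) (ℚP.neg-distribˡ-* 1ℚ q)
  convergent-correct (suc k) r s R S r≈R s≈S n = begin
    coef ((qInt (suc (suc k)) *P r) -P (0ℚ ∷ shiftP k s)) n
      ≡⟨ coef-minusP (qInt (suc (suc k)) *P r) (0ℚ ∷ shiftP k s) n ⟩
    coef (qInt (suc (suc k)) *P r) n ℚ.- coef (0ℚ ∷ shiftP k s) n
      ≡⟨ cong (ℚ._- coef (0ℚ ∷ shiftP k s) n) (coef-qInt-suc (suc k) r n) ⟩
    (coef r n ℚ.+ coef (0ℚ ∷ (qInt (suc k) *P r)) n) ℚ.- coef (0ℚ ∷ shiftP k s) n
      ≡⟨ ℚP.+-assoc (coef r n) _ _ ⟩
    coef r n ℚ.+ (coef (0ℚ ∷ (qInt (suc k) *P r)) n ℚ.- coef (0ℚ ∷ shiftP k s) n)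
      ≡⟨ cong₂ ℚ._+_ (r≈R n) (shifted n) ⟩
    coef (toℚ[x] R) n ℚ.+ coef (toℚ[x] (0ℤ ∷ convergent k R S)) n
      ≡⟨ coef-⊕ (toℚ[x] R) (toℚ[x] (0ℤ ∷ convergent k R S)) n ⟨
    coef (toℚ[x] R ⊕ toℚ[x] (0ℤ ∷ convergent k R S)) n
      ≡⟨ cong (λ f → coef f n) (ℤ→ℚ.map-⊕ R (0ℤ ∷ convergent k R S)) ⟨
    coef (toℚ[x] (convergent (suc k) R S)) n ∎
    where
    shifted : ∀ n → coef (0ℚ ∷ (qInt (suc k) *P r)) n ℚ.- coef (0ℚ ∷ shiftP k s) n ≡
                    coef (toℚ[x] (0ℤ ∷ convergent k R S)) n
    shifted zero    = refl
    shifted (suc n) = trans (sym (coef-minusP (qInt (suc k) *P r) (shiftP k s) n))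
      (convergent-correct k r s R S r≈R s≈S n)

  qInt-correct : ∀ k → qInt (suc k) ≈ₚ toℚ[x] (convergent k (1ℤ ∷ []) [])
  qInt-correct zero    n       = refl
  qInt-correct (suc k) zero    = refl
  qInt-correct (suc k) (suc n) = qInt-correct k n

  RS-correct : ∀ f n d → 0 ℕ.< n →
    proj₁ (RSgt1 f n d) ≈ₚ toℚ[x] (proj₁ (RS f n d)) × proj₂ (RSgt1 f n d) ≈ₚ toℚ[x] (proj₂ (RS f n d))
  RS-correct zero    n d       0<n = (λ _ → refl) , (λ _ → refl)
  RS-correct (suc f) n zero    0<n = (λ _ → refl) , (λ _ → refl)
  RS-correct (suc f) n (suc d) 0<n with n % suc d ℕ.≟ 0
  ... | yes r≡0 = last (n / suc d) (trans (m≡m%n+[m/n]*n n (suc d)) (cong (ℕ._+ (n / suc d) ℕ.* suc d) r≡0)) , λ _ → refl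
    where
    last : ∀ q → n ≡ q ℕ.* suc d → qInt q ≈ₚ toℚ[x] (convergent (q ∸ 1) (1ℤ ∷ []) [])
    -- For q = 0 the truncated q ∸ 1 would turn [0] = 0 into [1] = 1; positivity of n excludes this.
    last zero    n≡0 = contradiction (subst (0 ℕ.<_) n≡0 0<n) λ ()
    last (suc k) _   = qInt-correct k
  ... | no  _ with RS-correct f (suc d) (suc d ∸ n % suc d) (ℕ.s≤s ℕ.z≤n)
  ...   | R≈ , S≈ = convergent-correct (n / suc d) (proj₁ rs) (proj₂ rs) (proj₁ RS′) (proj₂ RS′) R≈ S≈ , R≈
    where
    rs = RSgt1 f (suc d) (suc d ∸ n % suc d)
    RS′ = RS f (suc d) (suc d ∸ n % suc d)

-- From S of a / p to the numerator attached to p / s.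

module _ (p-1 : ℕ) where
  private p = suc p-1

  Saux-reaches : ∀ k a → ¬ + p ∣ a → + p ℤ.< a ℤ.+ + k ℤ.* + p →
    ∃ λ n → ¬ + p ∣ + n × Saux (suc k) a p ≡ proj₂ (RSgt1 p n p)
  Saux-reaches k a p∤a big with + p ℤ.<? a
  Saux-reaches k (+ n) p∤a big | yes _ = n , p∤a , refl
  Saux-reaches zero a p∤a big | no p≮a = contradiction (subst (+ p ℤ.<_) (ℤP.+-identityʳ a) big) p≮a
  Saux-reaches (suc k) a p∤a big | no _ = Saux-reaches k (a ℤ.+ + p)
    (λ p∣a+p → p∤a (ℤ∣.∣m+n∣n⇒∣m p∣a+p ℤ∣.∣-refl))
    (subst (+ p ℤ.<_) (shift a (+ k) (+ p)) big)
    where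
    shift : ∀ a k p → a ℤ.+ (1ℤ ℤ.+ k) ℤ.* p ≡ a ℤ.+ p ℤ.+ k ℤ.* p
    shift = solve-∀

  -- The second entry for n / p is the first entry for the tail of the expansion, p / s with s = p -
  -- (n mod p). As p does not divide n, this tail exists and 0 < s < p.
  RSgt1-second : ∀ n → ¬ + p ∣ + n →
    ∃ λ s → 0 ℕ.< s × s ℕ.< p × proj₂ (RSgt1 p n p) ≡ proj₁ (RSgt1 p-1 p s)
  RSgt1-second n p∤n with n % p ℕ.≟ 0
  ... | yes r≡0 = contradiction (ℤ∣.∣ᵤ⇒∣ (ℕ∣.m%n≡0⇒n∣m n p r≡0)) p∤n
  ... | no  r≢0 = p ∸ n % p , ℕP.m<n⇒0<n∸m (m%n<n n p) ,
    ℕP.∸-monoʳ-< (ℕP.n≢0⇒n>0 r≢0) (ℕP.<⇒≤ (m%n<n n p)) , refl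

  Sq-numerator : 0 ℕ.< p-1 → ∀ a → ¬ + p ∣ a →
    ∃ λ s → 0 ℕ.< s × s ℕ.< p × Sq a p ≡ proj₁ (RSgt1 p-1 p s)
  Sq-numerator 0<p-1 a p∤a with Saux-reaches (suc ℤ.∣ a ∣) a p∤a (fuel-suffices a p∤a)
    where
    grow : ∀ x y z → 0ℤ ℤ.< x ℤ.+ y ℤ.* z → z ℤ.< x ℤ.+ (1ℤ ℤ.+ y) ℤ.* z
    grow x y z 0<x+yz = subst₂ ℤ._<_ (ℤP.+-identityʳ z) (regroup x y z) (ℤP.+-monoʳ-< z 0<x+yz)
      where
      regroup : ∀ x y z → z ℤ.+ (x ℤ.+ y ℤ.* z) ≡ x ℤ.+ (1ℤ ℤ.+ y) ℤ.* z
      regroup = solve-∀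
    fuel-suffices : ∀ a → ¬ + p ∣ a → + p ℤ.< a ℤ.+ + suc ℤ.∣ a ∣ ℤ.* + p
    fuel-suffices (+ zero)  p∤a = contradiction (divides 0ℤ refl) p∤a
    fuel-suffices (+ suc n) p∤a = grow (+ suc n) (+ suc n) (+ p) (ℤ.+<+ (ℕ.s≤s ℕ.z≤n))
    -- With m = n + 1 and a = -m, the quantity a + m p equals m (p - 1), which is positive because p
    -- ≥ 2; one further translation passes p.
    fuel-suffices -[1+ n ]  p∤a = grow -[1+ n ] (+ suc n) (+ p)
      (subst (0ℤ ℤ.<_) (trans (ℤP.pos-* (suc n) p-1) (negative (+ suc n) (+ p-1)))
        (ℤ.+<+ (ℕP.*-mono-≤ {1} {suc n} (ℕ.s≤s ℕ.z≤n) 0<p-1)))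
      where
      negative : ∀ m q → m ℤ.* q ≡ ℤ.- m ℤ.+ m ℤ.* (1ℤ ℤ.+ q)
      negative = solve-∀
  ... | n , p∤n , Sq≡ with RSgt1-second n p∤n
  ...   | s , 0<s , s<p , second≡ = s , 0<s , s<p , trans Sq≡ second≡

-- Units of the quadratic rings and recovery of a factor from its values.

module _ where
  open ℤ[x]
  open import Data.Integer using (∣_∣)
  open import Data.Nat using (_≤_)

  small-square : ∀ i → i ℤ.* i ℤ.< + 4 → i ∈ 0ℤ ∷ signs
  small-square (+ 0)            _ = here refl
  small-square (+ 1)            _ = there (here refl)
  small-square (-[1+ 0 ])       _ = there (there (here refl))
  small-square (+ suc (suc n))  (ℤ.+<+ lt) =
    contradiction (ℕP.<-≤-trans lt
      (ℕP.*-mono-≤ {2} {suc (suc n)} (ℕ.s≤s (ℕ.s≤s ℕ.z≤n)) (ℕ.s≤s (ℕ.s≤s ℕ.z≤n)))) (ℕP.<-irrefl refl)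
  small-square (-[1+ suc n ])   (ℤ.+<+ lt) =
    contradiction (ℕP.<-≤-trans lt
      (ℕP.*-mono-≤ {2} {suc (suc n)} (ℕ.s≤s (ℕ.s≤s ℕ.z≤n)) (ℕ.s≤s (ℕ.s≤s ℕ.z≤n)))) (ℕP.<-irrefl refl)

  module ℤ[i] = Quadratic 0ℤ
  module ℤ[ω] = Quadratic (ℤ.- 1ℤ)
  module ℤ[-1] = Quadratic (ℤ.- + 2)

  gaussian-unit : ∀ x → ℤ[i].norm x ≡ 1ℤ → x ∈ gaussianUnits
  gaussian-unit (a , b) N≡1 = units
    (small-square a (bounded (a ℤ.* a) (b ℤ.* b) (square≥0 b) (trans (sum a b) N≡1)))
    (small-square b (bounded (b ℤ.* b) (a ℤ.* a) (square≥0 a) (trans (ℤP.+-comm (b ℤ.* b) _) (trans (sum a b) N≡1))))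
    N≡1
    where
    sum : ∀ a b → a ℤ.* a ℤ.+ b ℤ.* b ≡ a ℤ.* a ℤ.+ 0ℤ ℤ.* (a ℤ.* b) ℤ.+ b ℤ.* b
    sum = solve-∀
    bounded : ∀ u v → 0ℤ ℤ.≤ v → u ℤ.+ v ≡ 1ℤ → u ℤ.< + 4
    bounded u v 0≤v u+v≡1 = ℤP.≤-<-trans (subst (ℤ._≤ u ℤ.+ v) (ℤP.+-identityʳ u) (ℤP.+-monoʳ-≤ u 0≤v))
      (subst (ℤ._< + 4) (sym u+v≡1) (ℤ.+<+ (ℕ.s≤s (ℕ.s≤s ℕ.z≤n))))
    units : ∀ {a b} → a ∈ 0ℤ ∷ signs → b ∈ 0ℤ ∷ signs → ℤ[i].norm (a , b) ≡ 1ℤ → (a , b) ∈ gaussianUnits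
    units (here refl) (here refl) ()
    units (here refl)                 (there (here refl))         _ = there (here refl)
    units (here refl)                 (there (there (here refl))) _ = there (there (there (here refl)))
    units (there (here refl))         (here refl)                 _ = here refl
    units (there (there (here refl))) (here refl)                 _ = there (there (here refl))
    units (there (here refl)) (there (here refl)) ()
    units (there (here refl)) (there (there (here refl))) ()
    units (there (there (here refl))) (there (here refl)) ()
    units (there (there (here refl))) (there (there (here refl))) ()

  -- Four times the norm is 3 a² + (2 b - a)², and likewise with a and b exchanged, so norm 1 forces
  -- both coordinates into {0, 1, -1}.
  eisenstein-unit : ∀ x → ℤ[ω].norm x ≡ 1ℤ → x ∈ eisensteinUnits
  eisenstein-unit (a , b) N≡1 = units
    (small-square a (bounded a (+ 2 ℤ.* b ℤ.- a) (complete₁ a b)))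
    (small-square b (bounded b (+ 2 ℤ.* a ℤ.- b) (complete₂ a b)))
    N≡1
    where
    complete₁ : ∀ a b → + 3 ℤ.* (a ℤ.* a) ℤ.+ (+ 2 ℤ.* b ℤ.- a) ℤ.* (+ 2 ℤ.* b ℤ.- a) ≡
      + 4 ℤ.* (a ℤ.* a ℤ.+ ℤ.- 1ℤ ℤ.* (a ℤ.* b) ℤ.+ b ℤ.* b)
    complete₁ = solve-∀
    complete₂ : ∀ a b → + 3 ℤ.* (b ℤ.* b) ℤ.+ (+ 2 ℤ.* a ℤ.- b) ℤ.* (+ 2 ℤ.* a ℤ.- b) ≡
      + 4 ℤ.* (a ℤ.* a ℤ.+ ℤ.- 1ℤ ℤ.* (a ℤ.* b) ℤ.+ b ℤ.* b)
    complete₂ = solve-∀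
    bounded : ∀ u v → + 3 ℤ.* (u ℤ.* u) ℤ.+ v ℤ.* v ≡ + 4 ℤ.* ℤ[ω].norm (a , b) → u ℤ.* u ℤ.< + 4
    bounded u v eq = ℤP.*-cancelˡ-<-nonNeg {u ℤ.* u} {+ 4} (+ 3) (ℤP.≤-<-trans
      (subst (ℤ._≤ + 3 ℤ.* (u ℤ.* u) ℤ.+ v ℤ.* v) (ℤP.+-identityʳ _) (ℤP.+-monoʳ-≤ (+ 3 ℤ.* (u ℤ.* u)) (square≥0 v)))
      (subst (ℤ._< + 12) (sym (trans eq (cong (λ N → + 4 ℤ.* N) N≡1))) (from-yes (+ 4 ℤ.<? + 12))))
    units : ∀ {a b} → a ∈ 0ℤ ∷ signs → b ∈ 0ℤ ∷ signs → ℤ[ω].norm (a , b) ≡ 1ℤ → (a , b) ∈ eisensteinUnits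
    units (here refl) (here refl) ()
    units (here refl)                 (there (here refl))         _ = there (here refl)
    units (here refl)                 (there (there (here refl))) _ = there (there (there (there (here refl))))
    units (there (here refl))         (here refl)                 _ = here refl
    units (there (here refl))         (there (here refl))         _ = there (there (here refl))
    units (there (there (here refl))) (here refl)                 _ = there (there (there (here refl)))
    units (there (there (here refl))) (there (there (here refl))) _ = there (there (there (there (there (here refl)))))
    units (there (here refl)) (there (there (here refl))) ()
    units (there (there (here refl))) (there (here refl)) ()

  -- For t = -2 the norm is the square of a - b, and a - b is the image of a + b θ under θ ↦ -1.
  unit-sign : ∀ x → ℤ[-1].norm x ≡ 1ℤ → proj₁ x ℤ.- proj₂ x ∈ signs
  unit-sign (a , b) N≡1 with unit-factor (a ℤ.- b) (a ℤ.- b) (trans (square a b) N≡1)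
    where
    square : ∀ a b → (a ℤ.- b) ℤ.* (a ℤ.- b) ≡ a ℤ.* a ℤ.+ ℤ.- + 2 ℤ.* (a ℤ.* b) ℤ.+ b ℤ.* b
    square = solve-∀
  ... | inj₁ e≡1  = here e≡1
  ... | inj₂ e≡-1 = there (here e≡-1)

  module _ (f₁ f₂ f₃ f₄ f₅ l : ℤ) where
    open import Data.Integer using (_+_; _-_; _*_; -_)

    private
      f = 1ℤ ∷ f₁ ∷ f₂ ∷ f₃ ∷ f₄ ∷ f₅ ∷ l ∷ []
      a = 1ℤ - f₂ + f₄ - l
      b = f₁ - f₃ + f₅
      c = 1ℤ + f₃ + l - f₂ - f₅
      d = f₁ + f₄ - f₂ - f₅
      e = 1ℤ - f₁ + f₂ - f₃ + f₄ - f₅ + l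

    at-i : ℤ[i].horner f ≡ (a , b)
    at-i = cong₂ _,_ (at-i₁ f₁ f₂ f₃ f₄ f₅ l) (at-i₂ f₁ f₂ f₃ f₄ f₅ l)
      where
      -- The chain x₆, y₆, ..., x₀, y₀ is `horner` unfolded on the seven coefficients, so that the
      -- solver meets only ring operations.
      at-i₁ : ∀ f₁ f₂ f₃ f₄ f₅ l →
        let x₆ = l - 0ℤ
            y₆ = 0ℤ + 0ℤ * 0ℤ
            x₅ = f₅ - y₆
            y₅ = x₆ + 0ℤ * y₆
            x₄ = f₄ - y₅
            y₄ = x₅ + 0ℤ * y₅
            x₃ = f₃ - y₄
            y₃ = x₄ + 0ℤ * y₄
            x₂ = f₂ - y₃
            y₂ = x₃ + 0ℤ * y₃
            x₁ = f₁ - y₂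
            y₁ = x₂ + 0ℤ * y₂
            x₀ = 1ℤ - y₁
            y₀ = x₁ + 0ℤ * y₁ in
        x₀ ≡ 1ℤ - f₂ + f₄ - l
      at-i₁ = solve-∀
      at-i₂ : ∀ f₁ f₂ f₃ f₄ f₅ l →
        let x₆ = l - 0ℤ
            y₆ = 0ℤ + 0ℤ * 0ℤ
            x₅ = f₅ - y₆
            y₅ = x₆ + 0ℤ * y₆
            x₄ = f₄ - y₅
            y₄ = x₅ + 0ℤ * y₅
            x₃ = f₃ - y₄
            y₃ = x₄ + 0ℤ * y₄
            x₂ = f₂ - y₃
            y₂ = x₃ + 0ℤ * y₃
            x₁ = f₁ - y₂
            y₁ = x₂ + 0ℤ * y₂
            x₀ = 1ℤ - y₁
            y₀ = x₁ + 0ℤ * y₁ in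
        y₀ ≡ f₁ - f₃ + f₅
      at-i₂ = solve-∀

    at-ω : ℤ[ω].horner f ≡ (c , d)
    at-ω = cong₂ _,_ (at-ω₁ f₁ f₂ f₃ f₄ f₅ l) (at-ω₂ f₁ f₂ f₃ f₄ f₅ l)
      where
      at-ω₁ : ∀ f₁ f₂ f₃ f₄ f₅ l →
        let x₆ = l - 0ℤ
            y₆ = 0ℤ + - 1ℤ * 0ℤ
            x₅ = f₅ - y₆
            y₅ = x₆ + - 1ℤ * y₆
            x₄ = f₄ - y₅
            y₄ = x₅ + - 1ℤ * y₅
            x₃ = f₃ - y₄
            y₃ = x₄ + - 1ℤ * y₄
            x₂ = f₂ - y₃
            y₂ = x₃ + - 1ℤ * y₃
            x₁ = f₁ - y₂
            y₁ = x₂ + - 1ℤ * y₂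
            x₀ = 1ℤ - y₁
            y₀ = x₁ + - 1ℤ * y₁ in
        x₀ ≡ 1ℤ + f₃ + l - f₂ - f₅
      at-ω₁ = solve-∀
      at-ω₂ : ∀ f₁ f₂ f₃ f₄ f₅ l →
        let x₆ = l - 0ℤ
            y₆ = 0ℤ + - 1ℤ * 0ℤ
            x₅ = f₅ - y₆
            y₅ = x₆ + - 1ℤ * y₆
            x₄ = f₄ - y₅
            y₄ = x₅ + - 1ℤ * y₅
            x₃ = f₃ - y₄
            y₃ = x₄ + - 1ℤ * y₄
            x₂ = f₂ - y₃
            y₂ = x₃ + - 1ℤ * y₃
            x₁ = f₁ - y₂
            y₁ = x₂ + - 1ℤ * y₂
            x₀ = 1ℤ - y₁
            y₀ = x₁ + - 1ℤ * y₁ in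
        y₀ ≡ f₁ + f₄ - f₂ - f₅
      at-ω₂ = solve-∀

    at-minus-1 : proj₁ (ℤ[-1].horner f) - proj₂ (ℤ[-1].horner f) ≡ e
    at-minus-1 = at-1 f₁ f₂ f₃ f₄ f₅ l
      where
      at-1 : ∀ f₁ f₂ f₃ f₄ f₅ l →
        let x₆ = l - 0ℤ
            y₆ = 0ℤ + - + 2 * 0ℤ
            x₅ = f₅ - y₆
            y₅ = x₆ + - + 2 * y₆
            x₄ = f₄ - y₅
            y₄ = x₅ + - + 2 * y₅
            x₃ = f₃ - y₄
            y₃ = x₄ + - + 2 * y₄
            x₂ = f₂ - y₃
            y₂ = x₃ + - + 2 * y₃
            x₁ = f₁ - y₂
            y₁ = x₂ + - + 2 * y₂
            x₀ = 1ℤ - y₁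
            y₀ = x₁ + - + 2 * y₁ in
        x₀ - y₀ ≡ 1ℤ - f₁ + f₂ - f₃ + f₄ - f₅ + l
      at-1 = solve-∀


    interpolation : interpolant l (a , b) e (c , d) ≡ f
    interpolation = trans (cong₂ (assemble l a c d) g₂≡
        (trans (cong₂ (λ g₃ g₂ → g₃ + l + g₂) g₃≡ g₂≡) (f₃-restore f₂ f₃ l)))
      assembled
      where
      f₂-identity : ∀ f₁ f₂ f₃ f₄ f₅ l →
        + 2 * (f₁ + f₄ - f₂ - f₅) + + 6 + + 4 * l - + 4 * (1ℤ + f₃ + l - f₂ - f₅) - (1ℤ - f₂ + f₄ - l)
          - (1ℤ - f₁ + f₂ - f₃ + f₄ - f₅ + l) - + 3 * (f₁ - f₃ + f₅) ≡ + 2 * f₂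
      f₂-identity = solve-∀
      f₃-identity : ∀ f₁ f₂ f₃ f₄ f₅ l →
        (1ℤ - f₂ + f₄ - l) - (1ℤ - f₁ + f₂ - f₃ + f₄ - f₅ + l) - (f₁ - f₃ + f₅) ≡ + 2 * (f₃ - l - f₂)
      f₃-identity = solve-∀
      f₃-restore : ∀ f₂ f₃ l → f₃ - l - f₂ + l + f₂ ≡ f₃
      f₃-restore = solve-∀
      f₄-restore : ∀ f₂ f₄ l → 1ℤ - f₂ + f₄ - l - 1ℤ + l + f₂ ≡ f₄
      f₄-restore = solve-∀
      f₅-restore : ∀ f₂ f₃ f₅ l → 1ℤ + f₃ + l - (1ℤ + f₃ + l - f₂ - f₅) - f₂ ≡ f₅
      f₅-restore = solve-∀
      f₁-restore : ∀ f₁ f₂ f₄ f₅ → f₁ + f₄ - f₂ - f₅ + f₂ + f₅ - f₄ ≡ f₁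
      f₁-restore = solve-∀

      assembled : assemble l a c d f₂ f₃ ≡ f
      assembled = cong₂ (λ g₁ (g₄ , g₅) → 1ℤ ∷ g₁ ∷ f₂ ∷ f₃ ∷ g₄ ∷ g₅ ∷ l ∷ [])
        (trans (cong₂ (λ g₄ g₅ → d + f₂ + g₅ - g₄) g₄≡ g₅≡) (f₁-restore f₁ f₂ f₄ f₅))
        (cong₂ _,_ g₄≡ g₅≡)
        where
        g₄≡ = f₄-restore f₂ f₄ l
        g₅≡ = f₅-restore f₂ f₃ f₅ l

      g₂≡ : half (+ 2 * d + + 6 + + 4 * l - + 4 * c - a - e - + 3 * b) ≡ f₂
      g₂≡ = trans (cong half (f₂-identity f₁ f₂ f₃ f₄ f₅ l)) (half-double f₂)

      g₃≡ : half (a - e - b) ≡ f₃ - l - f₂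
      g₃≡ = trans (cong half (f₃-identity f₁ f₂ f₃ f₄ f₅ l)) (half-double (f₃ - l - f₂))

  truncate : ∀ f → Degree≤ f 6 →
    f ≈ₚ coef f 0 ∷ coef f 1 ∷ coef f 2 ∷ coef f 3 ∷ coef f 4 ∷ coef f 5 ∷ coef f 6 ∷ []
  truncate f f≤6 0 = refl
  truncate f f≤6 1 = refl
  truncate f f≤6 2 = refl
  truncate f f≤6 3 = refl
  truncate f f≤6 4 = refl
  truncate f f≤6 5 = refl
  truncate f f≤6 6 = refl
  truncate f f≤6 (suc (suc (suc (suc (suc (suc (suc n))))))) =
    f≤6 (7 ℕ.+ n) (ℕ.s≤s (ℕP.m≤m+n 6 n))

  ≤6-excluded : ∀ f → coef f 0 ≡ 1ℤ → coef f 6 ∈ 0ℤ ∷ signs → Degree≤ f 6 →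
    ℤ[i].norm (ℤ[i].at-θ f) ≡ 1ℤ → ℤ[-1].norm (ℤ[-1].at-θ f) ≡ 1ℤ → ℤ[ω].norm (ℤ[ω].at-θ f) ≡ 1ℤ →
    ∃ λ g → f ≈ₚ g × Excluded g
  ≤6-excluded f f₀≡1 l∈ f≤6 Ni≡1 N-1≡1 Nω≡1 = g , f≈g ,
    subst Excluded (interpolation c₁ c₂ c₃ c₄ c₅ c₆)
      (All.lookup (All.lookup (All.lookup (All.lookup interpolants-excluded l∈) u∈) e∈) v∈)
    where
    c₁ = coef f 1
    c₂ = coef f 2
    c₃ = coef f 3
    c₄ = coef f 4
    c₅ = coef f 5
    c₆ = coef f 6
    g = 1ℤ ∷ c₁ ∷ c₂ ∷ c₃ ∷ c₄ ∷ c₅ ∷ c₆ ∷ []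
    f≈g : f ≈ₚ g
    f≈g n = trans (truncate f f≤6 n) (cong (λ a → coef (a ∷ c₁ ∷ c₂ ∷ c₃ ∷ c₄ ∷ c₅ ∷ c₆ ∷ []) n) f₀≡1)

    u∈ = subst (_∈ gaussianUnits)
      (trans (ℤ[i].at-θ-cong {f} {g} f≈g) (trans (ℤ[i].at-θ≡horner g) (at-i c₁ c₂ c₃ c₄ c₅ c₆)))
      (gaussian-unit (ℤ[i].at-θ f) Ni≡1)
    e∈ = subst (_∈ signs)
      (trans (cong (λ x → proj₁ x ℤ.- proj₂ x) (trans (ℤ[-1].at-θ-cong {f} {g} f≈g) (ℤ[-1].at-θ≡horner g)))
        (at-minus-1 c₁ c₂ c₃ c₄ c₅ c₆))
      (unit-sign (ℤ[-1].at-θ f) N-1≡1)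
    v∈ = subst (_∈ eisensteinUnits)
      (trans (ℤ[ω].at-θ-cong {f} {g} f≈g) (trans (ℤ[ω].at-θ≡horner g) (at-ω c₁ c₂ c₃ c₄ c₅ c₆)))
      (eisenstein-unit (ℤ[ω].at-θ f) Nω≡1)

  -- The invariant form bounds the norm of R(θ) by (2 - t) / (1 - t), and since
  -- θ ≡ 1 modulo 1 - θ that norm is ≡ p² modulo 2 - t; only 1 is left.
  norm-unit : ∀ t {ℓ p n d R S} → Prime ℓ → ¬ (+ ℓ ∣ + p) → + ℓ ∣ + 2 ℤ.- t →
    0ℤ ℤ.≤ (+ 2 ℤ.- t) ℤ.* (+ 2 ℤ.+ t) → 0ℤ ℤ.< + 2 ℤ.- t →
    (∀ k → (1ℤ ℤ.- t) ℤ.* + k ℤ.≤ + 2 ℤ.- t → k ≡ 1 ⊎ + ℓ ∣ + k) →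
    QRational n d R S → eval 1ℤ R ≡ + p →
    let open Quadratic t in norm (at-θ R) ≡ 1ℤ
  norm-unit t {ℓ} {p} {R = R} {S} ℓ-prime ℓ∤p ℓ∣m 0≤4-t² 0<m small q R[1]≡p =
    conclude (norm (at-θ R)) (norm≥0 0≤4-t² (at-θ R))
      (norm-bound 0≤4-t² 0<m (at-θ R) (at-θ S) (qRational-form t q)) ℓ∤norm
    where
    open Quadratic t
    ℓ∤norm : ¬ (+ ℓ ∣ norm (at-θ R))
    ℓ∤norm ℓ∣N = [ ℓ∤p , ℓ∤p ]′ (euclid ℓ-prime (+ p) (+ p) (subst (λ v → + ℓ ∣ v ℤ.* v) R[1]≡p
      (ℤ∣.∣m+n∣n⇒∣m (subst (+ ℓ ∣_) (proj₂ (norm-mod R)) ℓ∣N) (ℤ∣.∣m⇒∣m*n (proj₁ (norm-mod R)) ℓ∣m))))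
    conclude : ∀ N → 0ℤ ℤ.≤ N → (1ℤ ℤ.- t) ℤ.* N ℤ.≤ + 2 ℤ.- t → ¬ (+ ℓ ∣ N) → N ≡ 1ℤ
    conclude (+ k) _ N≤ ℓ∤N with small k N≤
    ... | inj₁ k≡1 = cong +_ k≡1
    ... | inj₂ ℓ∣N = contradiction ℓ∣N ℓ∤N

  nonNegative-unit : ∀ {i} j → 0ℤ ℤ.≤ i → i ℤ.* j ≡ 1ℤ → i ≡ 1ℤ
  nonNegative-unit {i} j 0≤i ij≡1 =
    [ id , (λ i≡-1 → contradiction (subst (0ℤ ℤ.≤_) i≡-1 0≤i) λ ()) ]′ (unit-factor i j ij≡1)

  -- The norm is multiplicative with nonnegative integer values, so a product of norm 1 has factors
  -- of norm 1.
  factor-norm : ∀ t {f h P} → 0ℤ ℤ.≤ (+ 2 ℤ.- t) ℤ.* (+ 2 ℤ.+ t) → f ⊗ h ≈ₚ P →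
    let open Quadratic t in norm (at-θ P) ≡ 1ℤ → norm (at-θ f) ≡ 1ℤ
  factor-norm t {f} {h} {P} 0≤4-t² fh≈P NP≡1 =
    nonNegative-unit (norm (at-θ h)) (norm≥0 0≤4-t² (at-θ f))
      (trans (sym (norm-✖ (at-θ f) (at-θ h)))
        (trans (cong norm (trans (sym (at-θ-⊗ f h)) (at-θ-cong {f ⊗ h} {P} fh≈P))) NP≡1))
    where open Quadratic t

  -- Integral factors of degree at most 6.

  Monic : List ℤ → ℕ → Set
  Monic P n = coef P n ≡ 1ℤ × Degree≤ P n

  cofactor-degree : ∀ {f h P n d} → f ⊗ h ≈ₚ P → Monic P n → coef f d ≢ 0ℤ → Degree≤ f d →
    ∃ λ e → Degree≤ h e × d ℕ.+ e ≡ n × coef f d ℤ.* coef h e ≡ 1ℤ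
  cofactor-degree {f} {h} {P} {n} {d} fh≈P (P≡1 , P≤n) fd≢0 f≤d with degree ℤ._≟_ h
  ... | inj₁ h≈0 = contradiction
    (trans (sym P≡1) (trans (sym (fh≈P n)) (trans (⊗-congʳ f {h} {[]} h≈0 n) (⊗-comm f [] n)))) λ ()
  ... | inj₂ (e , he≢0 , h≤e) = e , h≤e , d+e≡n , trans (sym (⊗-leading f h d e f≤d h≤e))
      (trans (fh≈P (d ℕ.+ e)) (trans (cong (coef P) d+e≡n) P≡1))
    where
    leading≢0 : coef P (d ℕ.+ e) ≢ 0ℤ
    leading≢0 eq = [ fd≢0 , he≢0 ]′ (ℤP.i*j≡0⇒i≡0∨j≡0 (coef f d)
      (trans (sym (⊗-leading f h d e f≤d h≤e)) (trans (fh≈P (d ℕ.+ e)) eq)))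
    d+e≡n : d ℕ.+ e ≡ n
    d+e≡n = ℕP.≤-antisym
      (ℕP.≮⇒≥ λ n<d+e → leading≢0 (P≤n (d ℕ.+ e) n<d+e))
      (ℕP.≮⇒≥ λ d+e<n → contradiction
        (trans (sym P≡1) (trans (sym (fh≈P n)) (⊗-degree≤ f h d e f≤d h≤e n d+e<n))) λ ())

  -- Here d only bounds the degree, whence the value 0. If the coefficient is nonzero it is a
  -- leading one, and leading coefficients multiply to 1.
  leading-unit : ∀ {f h P n} d → f ⊗ h ≈ₚ P → Monic P n → Degree≤ f d → coef f d ∈ 0ℤ ∷ signs
  leading-unit {f} {h} {P} d fh≈P monic f≤d with coef f d ℤ.≟ 0ℤ
  ... | yes fd≡0 = here fd≡0
  ... | no  fd≢0 =
    let e , _ , _ , fd*he≡1 = cofactor-degree {f} {h} {P} fh≈P monic fd≢0 f≤d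
    in [ (λ fd≡1 → there (here fd≡1)) , (λ fd≡-1 → there (there (here fd≡-1))) ]′ (unit-factor (coef f d) (coef h e) fd*he≡1)

  module _ {f h P : List ℤ} (fh≈P : f ⊗ h ≈ₚ P) (f₀≡1 : coef f 0 ≡ 1ℤ) (P₀≡1 : coef P 0 ≡ 1ℤ) where

    constant-of-cofactor : coef h 0 ≡ 1ℤ
    constant-of-cofactor = trans (sym (ℤP.*-identityˡ (coef h 0)))
      (trans (cong (ℤ._* coef h 0) (sym f₀≡1)) (trans (sym (coef-⊗-zero f h)) (trans (fh≈P 0) P₀≡1)))

    constant-factor : Degree≤ f 0 → f ≈ₚ 1ℤ ∷ []
    constant-factor f≤0 zero    = f₀≡1
    constant-factor f≤0 (suc n) = f≤0 (suc n) (ℕ.s≤s ℕ.z≤n)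

    constant-cofactor : Degree≤ h 0 → f ≈ₚ P
    constant-cofactor h≤0 n = trans (sym (1⊙ f n))
      (trans (sym (⊗-constant f 1ℤ n)) (trans (sym (⊗-congʳ f {h} {1ℤ ∷ []} h≈1 n)) (fh≈P n)))
      where
      h≈1 : h ≈ₚ 1ℤ ∷ []
      h≈1 zero    = constant-of-cofactor
      h≈1 (suc n) = h≤0 (suc n) (ℕ.s≤s ℕ.z≤n)

    factor≉0 : ¬ f ≈ₚ []
    factor≉0 f≈0 = contradiction (trans (sym f₀≡1) (f≈0 0)) λ ()

    factor-of-linear : Monic P 1 → f ≈ₚ 1ℤ ∷ [] ⊎ f ≈ₚ P
    factor-of-linear monic with degree ℤ._≟_ f
    ... | inj₁ f≈0 = contradiction f≈0 factor≉0
    ... | inj₂ (d , fd≢0 , f≤d) = by-degree d f≤d (cofactor-degree {f} {h} {P} fh≈P monic fd≢0 f≤d)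
      where
      by-degree : ∀ d → Degree≤ f d → (∃ λ e → Degree≤ h e × d ℕ.+ e ≡ 1 × coef f d ℤ.* coef h e ≡ 1ℤ) →
        f ≈ₚ 1ℤ ∷ [] ⊎ f ≈ₚ P
      by-degree zero          f≤0 _                   = inj₁ (constant-factor f≤0)
      by-degree (suc zero)    _   (zero , h≤0 , _)    = inj₂ (constant-cofactor h≤0)
      by-degree (suc zero)    _   (suc e , _ , () , _)
      by-degree (suc (suc d)) _   (_ , _ , () , _)

    factor-of-1+x+x² : P ≡ 1ℤ ∷ 1ℤ ∷ 1ℤ ∷ [] → f ≈ₚ 1ℤ ∷ [] ⊎ f ≈ₚ P
    factor-of-1+x+x² refl with degree ℤ._≟_ f
    ... | inj₁ f≈0 = contradiction f≈0 factor≉0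
    ... | inj₂ (d , fd≢0 , f≤d) = by-degree d f≤d (cofactor-degree {f} {h} {P} fh≈P monic fd≢0 f≤d)
      where
      monic : Monic P 2
      monic = refl , λ { (suc (suc (suc n))) (ℕ.s≤s (ℕ.s≤s (ℕ.s≤s _))) → refl }

      -- Two linear factors 1 + u x and 1 + v x would need u v = 1 and u + v = 1, but u = ±1 solves
      -- neither.
      no-linear : coef f 1 ℤ.* coef h 1 ≡ 1ℤ → ⊥
      no-linear f₁h₁≡1 = impossible f₁[1-f₁]≡1 (unit-factor (coef f 1) (coef h 1) f₁h₁≡1)
        where
        sum : coef h 1 ℤ.+ coef f 1 ≡ 1ℤ
        sum = trans (cong₂ ℤ._+_ (sym (trans (cong (ℤ._* coef h 1) f₀≡1) (ℤP.*-identityˡ _)))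
                      (sym (trans (cong (λ u → coef f 1 ℤ.* u) constant-of-cofactor) (ℤP.*-identityʳ _))))
          (trans (sym (product-coefficient f)) (fh≈P 1))
          where
          product-coefficient : ∀ f → coef (f ⊗ h) 1 ≡ coef f 0 ℤ.* coef h 1 ℤ.+ coef f 1 ℤ.* coef h 0
          product-coefficient []      = refl
          product-coefficient (a ∷ f) = trans (coef-⊗-suc a f h 0) (cong (λ u → a ℤ.* coef h 1 ℤ.+ u) (coef-⊗-zero f h))
        f₁[1-f₁]≡1 : coef f 1 ℤ.* (1ℤ ℤ.- coef f 1) ≡ 1ℤ
        f₁[1-f₁]≡1 = trans (cong (λ v → coef f 1 ℤ.* v)
          (trans (cong (ℤ._- coef f 1) (sym sum)) (cancel (coef h 1) (coef f 1)))) f₁h₁≡1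
          where
          cancel : ∀ u v → u ℤ.+ v ℤ.- v ≡ u
          cancel = solve-∀
        impossible : ∀ {v} → v ℤ.* (1ℤ ℤ.- v) ≡ 1ℤ → v ≡ 1ℤ ⊎ v ≡ ℤ.- 1ℤ → ⊥
        impossible () (inj₁ refl)
        impossible () (inj₂ refl)

      by-degree : ∀ d → Degree≤ f d → (∃ λ e → Degree≤ h e × d ℕ.+ e ≡ 2 × coef f d ℤ.* coef h e ≡ 1ℤ) →
        f ≈ₚ 1ℤ ∷ [] ⊎ f ≈ₚ P
      by-degree zero f≤0 _ = inj₁ (constant-factor f≤0)
      by-degree 1 _ (1 , _ , _ , f₁h₁≡1) = ⊥-elim (no-linear f₁h₁≡1)
      by-degree 1 _ (zero , _ , () , _)
      by-degree 1 _ (suc (suc e) , _ , () , _)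
      by-degree 2 _ (zero , h≤0 , _) = inj₂ (constant-cofactor h≤0)
      by-degree 2 _ (suc e , _ , () , _)
      by-degree (suc (suc (suc d))) _ (_ , _ , () , _)

  prime-divisor : ∀ {ℓ p} → Prime ℓ → Prime p → ℓ ≢ p → ¬ (+ ℓ ∣ + p)
  prime-divisor {ℓ} ℓ-prime p-prime ℓ≢p ℓ∣p with prime⇒irreducible p-prime (ℤ∣.∣⇒∣ᵤ ℓ∣p)
  ... | inj₁ ℓ≡1 = ¬prime[1] (subst Prime ℓ≡1 ℓ-prime)
  ... | inj₂ ℓ≡p = ℓ≢p ℓ≡p

  -- The common multiple g divides both p and s, and 0 < s < p, so g = ±1. Nonnegative coefficients
  -- make R(1) nonnegative and settle the sign.
  qRational-at-1-prime : ∀ {p s R S} → Prime p → 0 ℕ.< s → s ℕ.< p → QRational p s R S → eval 1ℤ R ≡ + p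
  qRational-at-1-prime {p} {s} {R} {S} p-prime 0<s s<p q with qRational-at-1 q
  ... | g , p≡gR , s≡gS with prime⇒irreducible p-prime (ℤ∣.∣⇒∣ᵤ {g} {+ p} (divides (eval 1ℤ R) (trans p≡gR (ℤP.*-comm g _))))
  ...   | inj₂ ∣g∣≡p = contradiction s<p (ℕP.≤⇒≯ (ℕ∣.∣⇒≤ {{ℕ.>-nonZero 0<s}}
          (subst (ℕ∣._∣ s) ∣g∣≡p (ℤ∣.∣⇒∣ᵤ {g} {+ s} (divides (eval 1ℤ S) (trans s≡gS (ℤP.*-comm g _)))))))
  ...   | inj₁ ∣g∣≡1 = conclude (eval 1ℤ R) (eval-1≥0 R (proj₁ (qRational-nonNegative q)))
          (trans (cong ∣_∣ p≡gR) (trans (ℤP.abs-* g _) (trans (cong (ℕ._* ∣ eval 1ℤ R ∣) ∣g∣≡1) (ℕP.*-identityˡ _))))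
    where
    eval-1≥0 : ∀ f → NonNegative f → 0ℤ ℤ.≤ eval 1ℤ f
    eval-1≥0 []      f≥0 = ℤ.+≤+ ℕ.z≤n
    eval-1≥0 (a ∷ f) f≥0 = ℤP.+-mono-≤ (f≥0 0)
      (subst (0ℤ ℤ.≤_) (sym (ℤP.*-identityˡ _)) (eval-1≥0 f (λ n → f≥0 (suc n))))
    conclude : ∀ v → 0ℤ ℤ.≤ v → p ≡ ∣ v ∣ → v ≡ + p
    conclude (+ n) _ p≡n = cong +_ (sym p≡n)

  numerator-qRational : ∀ {p s} → 0 ℕ.< s → s ℕ.< p → QRational p s (numerator p s) (proj₂ (RS (p ∸ 1) p s))
  numerator-qRational {suc p-1} {s} 0<s s<p = RS-qRational p-1 (suc p-1) s 0<s (ℕP.≤-pred s<p) s<p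

  module _ {p s : ℕ} (p-prime : Prime p) (0<s : 0 ℕ.< s) (s<p : s ℕ.< p) (2≢p : 2 ≢ p) (3≢p : 3 ≢ p) where

    private
      P = numerator p s

      P-qRational = numerator-qRational 0<s s<p

      P[1]≡p : eval 1ℤ P ≡ + p
      P[1]≡p = qRational-at-1-prime p-prime 0<s s<p P-qRational

      2-prime : Prime 2
      2-prime = from-yes (prime? 2)

      3-prime : Prime 3
      3-prime = from-yes (prime? 3)

      2∤p : ¬ (+ 2 ∣ + p)
      2∤p = prime-divisor 2-prime p-prime 2≢p

      3∤p : ¬ (+ 3 ∣ + p)
      3∤p = prime-divisor 3-prime p-prime 3≢p

      ≥0 : ∀ {n} → 0ℤ ℤ.≤ + n
      ≥0 = ℤ.+≤+ ℕ.z≤n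

      >0 : ∀ {n} → 0ℤ ℤ.< + suc n
      >0 = ℤ.+<+ (ℕ.s≤s ℕ.z≤n)

      -- At i the bound still admits 2, which the congruence removes together with 0; at ω and -1
      -- only 0 and 1 remain.
      small-i : ∀ k → + 1 ℤ.* + k ℤ.≤ + 2 → k ≡ 1 ⊎ + 2 ∣ + k
      small-i 0 _ = inj₂ (divides 0ℤ refl)
      small-i 1 _ = inj₁ refl
      small-i 2 _ = inj₂ (divides 1ℤ refl)
      small-i (suc (suc (suc k))) (ℤ.+≤+ (ℕ.s≤s (ℕ.s≤s ())))

      small-ω : ∀ k → + 2 ℤ.* + k ℤ.≤ + 3 → k ≡ 1 ⊎ + 3 ∣ + k
      small-ω 0 _ = inj₂ (divides 0ℤ refl)
      small-ω 1 _ = inj₁ refl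
      small-ω (suc (suc k)) (ℤ.+≤+ 2k≤3) =
        contradiction (ℕP.≤-trans (ℕP.*-monoʳ-≤ 2 {2} {suc (suc k)} (ℕ.s≤s (ℕ.s≤s ℕ.z≤n))) 2k≤3) (from-no (4 ℕ.≤? 3))

      small-minus-1 : ∀ k → + 3 ℤ.* + k ℤ.≤ + 4 → k ≡ 1 ⊎ + 2 ∣ + k
      small-minus-1 0 _ = inj₂ (divides 0ℤ refl)
      small-minus-1 1 _ = inj₁ refl
      small-minus-1 (suc (suc k)) (ℤ.+≤+ 3k≤4) =
        contradiction (ℕP.≤-trans (ℕP.*-monoʳ-≤ 3 {2} {suc (suc k)} (ℕ.s≤s (ℕ.s≤s ℕ.z≤n))) 3k≤4) (from-no (6 ℕ.≤? 4))

      norm-i : ℤ[i].norm (ℤ[i].at-θ P) ≡ 1ℤ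
      norm-i = norm-unit 0ℤ 2-prime 2∤p (divides 1ℤ refl) ≥0 >0 small-i P-qRational P[1]≡p

      norm-ω : ℤ[ω].norm (ℤ[ω].at-θ P) ≡ 1ℤ
      norm-ω = norm-unit (ℤ.- 1ℤ) 3-prime 3∤p (divides 1ℤ refl) ≥0 >0 small-ω P-qRational P[1]≡p

      norm-minus-1 : ℤ[-1].norm (ℤ[-1].at-θ P) ≡ 1ℤ
      norm-minus-1 = norm-unit (ℤ.- + 2) 2-prime 2∤p (divides (+ 2) refl) ≥0 >0 small-minus-1 P-qRational P[1]≡p

    module _ {f h : List ℤ} (fh≈P : f ⊗ h ≈ₚ P) (f₀≡1 : coef f 0 ≡ 1ℤ) (f≤6 : Degree≤ f 6) where

      private
        f[_]>0 : ∀ m → 0ℤ ℤ.< eval (+ m) f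
        f[_]>0 = factor-positive {f} {h} {P} fh≈P (proj₁ (qRational-nonNegative P-qRational)) (qRational-constant P-qRational) f₀≡1

        P-monic : ∃ (Monic P)
        P-monic with qRational-monic P-qRational
        ... | n , P≡1 , P≤n , _ = n , P≡1 , P≤n

        f[1]∣p : ∣ eval 1ℤ f ∣ ℕ∣.∣ p
        f[1]∣p = ℤ∣.∣⇒∣ᵤ {eval 1ℤ f} {+ p} (divides (eval 1ℤ h)
          (trans (sym P[1]≡p) (trans (sym (eval-cong 1ℤ {f ⊗ h} {P} fh≈P))
            (trans (eval-⊗ 1ℤ f h) (ℤP.*-comm (eval 1ℤ f) (eval 1ℤ h))))))

        f[1]≡p : eval 1ℤ f ≢ 1ℤ → ∣ eval 1ℤ f ∣ ≡ p
        f[1]≡p f[1]≢1 = [ (λ eq → contradiction (trans (sym (ℤP.0≤i⇒+∣i∣≡i (ℤP.<⇒≤ f[ 1 ]>0))) (cong +_ eq)) f[1]≢1) , id ]′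
          (prime⇒irreducible p-prime f[1]∣p)

        module _ {g} (f≈g : f ≈ₚ g) where

          f[1]≡g[1] : eval 1ℤ f ≡ eval 1ℤ g
          f[1]≡g[1] = eval-cong 1ℤ {f} {g} f≈g

          from-entry : (g ≈ₚ P ⊎ ¬ eval (+ 3) g ℤᵤ.∣ eval (+ 3) P) → f ≈ₚ P
          from-entry (inj₁ g≈P) n = trans (f≈g n) (g≈P n)
          from-entry (inj₂ g∤P)   = contradiction (ℤ∣.∣⇒∣ᵤ {eval (+ 3) g} {eval (+ 3) P} (divides (eval (+ 3) h)
            (trans (sym (eval-cong (+ 3) {f ⊗ h} {P} fh≈P))
              (trans (eval-⊗ (+ 3) f h) (trans (ℤP.*-comm (eval (+ 3) f) (eval (+ 3) h))
                (cong (λ u → eval (+ 3) h ℤ.* u) (eval-cong (+ 3) {f} {g} f≈g))))))) g∤P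

          from-excluded : Excluded g → f ≈ₚ 1ℤ ∷ [] ⊎ f ≈ₚ P
          from-excluded (inj₁ g[1]≤0) =
            contradiction (subst (0ℤ ℤ.<_) f[1]≡g[1] f[ 1 ]>0) (ℤP.≤⇒≯ g[1]≤0)
          from-excluded (inj₂ (inj₁ g[2]≤0)) =
            contradiction (subst (0ℤ ℤ.<_) (eval-cong (+ 2) {f} {g} f≈g) f[ 2 ]>0) (ℤP.≤⇒≯ g[2]≤0)
          from-excluded (inj₂ (inj₂ (inj₁ g≈1))) = inj₁ λ n → trans (f≈g n) (g≈1 n)
          -- The value f(1) is a positive divisor of the prime p other than 1, so the row built for
          -- |g(1)| is the row for p.
          from-excluded (inj₂ (inj₂ (inj₂ (g[1]≢1 , table)))) =
            inj₂ (from-entry (lookup s 0<s s<p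
              (trans (cong ∣_∣ (sym f[1]≡g[1])) (f[1]≡p (λ f[1]≡1 → g[1]≢1 (trans (sym f[1]≡g[1]) f[1]≡1))))
              table))
            where
            lookup : ∀ s {k} → 0 ℕ.< s → s ℕ.< p → k ≡ p → TableRow g k →
              g ≈ₚ numerator p s ⊎ ¬ eval (+ 3) g ℤᵤ.∣ eval (+ 3) (numerator p s)
            -- Positions in the row start at 0 while s starts at 1.
            lookup (suc s) _ s<p refl table = All.lookup table (∈-upTo⁺ (ℕP.∸-monoˡ-≤ 1 s<p))

      factor-≤6 : f ≈ₚ 1ℤ ∷ [] ⊎ f ≈ₚ P
      factor-≤6 = from-excluded (proj₁ (proj₂ excluded)) (proj₂ (proj₂ excluded))
        where
        excluded : ∃ λ g → f ≈ₚ g × Excluded g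
        excluded = ≤6-excluded f f₀≡1 (leading-unit {f} {h} {P} 6 fh≈P (proj₂ P-monic) f≤6) f≤6
          (factor-norm 0ℤ {f} {h} {P} ≥0 fh≈P norm-i)
          (factor-norm (ℤ.- + 2) {f} {h} {P} ≥0 fh≈P norm-minus-1)
          (factor-norm (ℤ.- 1ℤ) {f} {h} {P} ≥0 fh≈P norm-ω)

  numerator-factor : ∀ {p s} → Prime p → 0 ℕ.< s → s ℕ.< p → ∀ {f h} → f ⊗ h ≈ₚ numerator p s →
    coef f 0 ≡ 1ℤ → Degree≤ f 6 → f ≈ₚ 1ℤ ∷ [] ⊎ f ≈ₚ numerator p s
  numerator-factor {p} {s} p-prime 0<s s<p fh≈P f₀≡1 f≤6 with 2 ℕ.≟ p | 3 ℕ.≟ p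
  numerator-factor {s = 1} p-prime 0<s s<p {f} {h} fh≈P f₀≡1 f≤6 | yes refl | _ =
    factor-of-linear {f} {h} {numerator 2 1} fh≈P f₀≡1 refl (refl , λ { (suc (suc n)) _ → refl ; 1 (ℕ.s≤s ()) })
  numerator-factor {s = suc (suc s)} p-prime 0<s (ℕ.s≤s (ℕ.s≤s ())) fh≈P f₀≡1 f≤6 | yes refl | _
  numerator-factor {s = 1} p-prime 0<s s<p {f} {h} fh≈P f₀≡1 f≤6 | no _ | yes refl =
    factor-of-1+x+x² {f} {h} {numerator 3 1} fh≈P f₀≡1 refl refl
  numerator-factor {s = 2} p-prime 0<s s<p {f} {h} fh≈P f₀≡1 f≤6 | no _ | yes refl =
    factor-of-1+x+x² {f} {h} {numerator 3 2} fh≈P f₀≡1 refl refl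
  numerator-factor {s = suc (suc (suc s))} p-prime 0<s (ℕ.s≤s (ℕ.s≤s (ℕ.s≤s ()))) fh≈P f₀≡1 f≤6 | no _ | yes refl
  numerator-factor p-prime 0<s s<p {f} {h} fh≈P f₀≡1 f≤6 | no 2≢p | no 3≢p =
    factor-≤6 p-prime 0<s s<p 2≢p 3≢p {f} {h} fh≈P f₀≡1 f≤6

  -- Return to ℚ[x] and conclusion.

  module _ where
    open ℚ[x] using () renaming (coef to coefℚ; _≈ₚ_ to _≈ℚ_; _⊗_ to _⊗ℚ_; _⊙_ to _⊙ℚ_)

    ⊙-inverse : ∀ {c} f {g} → (c≢0 : c ≢ 0ℚ) → f ≈ℚ c ⊙ℚ g → g ≈ℚ (1/ c) {{ℚ.≢-nonZero c≢0}} ⊙ℚ f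
    ⊙-inverse {c} f {g} c≢0 f≈cg n = sym (begin
      coefℚ (1/c ⊙ℚ f) n              ≡⟨ ℚ[x].⊙-cong 1/c {f} {c ⊙ℚ g} f≈cg n ⟩
      coefℚ (1/c ⊙ℚ (c ⊙ℚ g)) n       ≡⟨ ℚ[x].⊙-⊙ 1/c c g n ⟩
      coefℚ ((1/c ℚ.* c) ⊙ℚ g) n      ≡⟨ cong (λ u → coefℚ (u ⊙ℚ g) n) (ℚP.*-inverseˡ c {{ℚ.≢-nonZero c≢0}}) ⟩
      coefℚ (1ℚ ⊙ℚ g) n               ≡⟨ ℚ[x].1⊙ g n ⟩
      coefℚ g n                       ∎)
      where
      open ≡-Reasoning
      1/c = (1/ c) {{ℚ.≢-nonZero c≢0}}

    unit-⊙ : ∀ {c} f → IsUnitP (c ⊙ℚ f) → IsUnitP f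
    unit-⊙ {c} f (k , cfk≈1) = c ⊙ℚ k , ≈ₚ⇒≈P {f *P (c ⊙ℚ k)} {oneP} λ n → begin
      coefℚ (f *P (c ⊙ℚ k)) n   ≡⟨ cong (λ u → coefℚ u n) (*P≡⊗ f (c ⊙ℚ k)) ⟩
      coefℚ (f ⊗ℚ (c ⊙ℚ k)) n   ≡⟨ ℚ[x].⊗-⊙ c f k n ⟩
      coefℚ (c ⊙ℚ (f ⊗ℚ k)) n   ≡⟨ ℚ[x].⊙-⊗ c f k n ⟨
      coefℚ ((c ⊙ℚ f) ⊗ℚ k) n   ≡⟨ cong (λ u → coefℚ u n) (*P≡⊗ (c ⊙ℚ f) k) ⟨
      coefℚ ((c ⊙ℚ f) *P k) n   ≡⟨ ≈P⇒≈ₚ {(c ⊙ℚ f) *P k} {oneP} cfk≈1 n ⟩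
      coefℚ oneP n              ∎
      where open ≡-Reasoning

    unit-cong : ∀ {f g} → f ≈ℚ g → IsUnitP f → IsUnitP g
    unit-cong {f} {g} f≈g (k , fk≈1) = k , ≈ₚ⇒≈P {g *P k} {oneP} λ n →
      trans (cong (λ u → coefℚ u n) (*P≡⊗ g k))
        (trans (sym (ℚ[x].⊗-congˡ {f} {g} k f≈g n))
          (trans (cong (λ u → coefℚ u n) (sym (*P≡⊗ f k))) (≈P⇒≈ₚ {f *P k} {oneP} fk≈1 n)))

    irreducible-⊙ : ∀ {c} f {g} → c ≢ 0ℚ → f ≈ℚ c ⊙ℚ g → IrreducibleP g → IrreducibleP f
    irreducible-⊙ {c} f {g} c≢0 f≈cg (g≉0 , g-nonunit , g-prime) = f≉0 , f-nonunit , f-prime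
      where
      1/c = (1/ c) {{ℚ.≢-nonZero c≢0}}
      g≈f/c : g ≈ℚ 1/c ⊙ℚ f
      g≈f/c = ⊙-inverse f {g} c≢0 f≈cg
      f≉0 : ¬ IsZeroP f
      f≉0 f≈0 = g≉0 (≈ₚ⇒≈P {g} {[]} λ n → trans (g≈f/c n) (ℚ[x].⊙-cong 1/c {f} {[]} (≈P⇒≈ₚ {f} {[]} f≈0) n))
      f-nonunit : ¬ IsUnitP f
      f-nonunit f-unit = g-nonunit (unit-⊙ {c} g (unit-cong {f} {c ⊙ℚ g} f≈cg f-unit))
      f-prime : ∀ u v → f ≈P u *P v → IsUnitP u ⊎ IsUnitP v
      f-prime u v f≈uv = [ (λ u/c-unit → inj₁ (unit-⊙ {1/c} u u/c-unit)) , inj₂ ]′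
        (g-prime (1/c ⊙ℚ u) v (≈ₚ⇒≈P {g} {(1/c ⊙ℚ u) *P v} λ n → begin
          coefℚ g n                       ≡⟨ g≈f/c n ⟩
          coefℚ (1/c ⊙ℚ f) n              ≡⟨ ℚ[x].⊙-cong 1/c {f} {u *P v} (≈P⇒≈ₚ {f} {u *P v} f≈uv) n ⟩
          coefℚ (1/c ⊙ℚ (u *P v)) n       ≡⟨ cong (λ w → coefℚ (1/c ⊙ℚ w) n) (*P≡⊗ u v) ⟩
          coefℚ (1/c ⊙ℚ (u ⊗ℚ v)) n       ≡⟨ ℚ[x].⊙-⊗ 1/c u v n ⟨
          coefℚ ((1/c ⊙ℚ u) ⊗ℚ v) n       ≡⟨ cong (λ w → coefℚ w n) (*P≡⊗ (1/c ⊙ℚ u) v) ⟨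
          coefℚ ((1/c ⊙ℚ u) *P v) n       ∎))
        where open ≡-Reasoning

    -- Gauss's lemma over ℚ; no contents are needed since P(0) = 1.
    integral-factor : ∀ {P} g h → coef P 0 ≡ 1ℤ → toℚ[x] P ≈ℚ g ⊗ℚ h →
      ∃ λ f → ∃ λ k → ∃ λ c → toℚ[x] f ≈ℚ c ⊙ℚ g × f ⊗ k ≈ₚ P × coef f 0 ≡ 1ℤ × c ≢ 0ℚ
    integral-factor {P} g h P₀≡1 P≈gh =
      f , k , 1/c ℚ.* fromℤ (+ N) , f≈ , fk≈P , f₀≡1 , scalar≢0
      where
      open ≡-Reasoning
      cleared-g = clear-denominators g
      cleared-h = clear-denominators h
      N = proj₁ cleared-g
      G = proj₁ (proj₂ cleared-g)
      G≈Ng = proj₂ (proj₂ (proj₂ cleared-g))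
      M = proj₁ cleared-h
      H = proj₁ (proj₂ cleared-h)
      H≈Mh = proj₂ (proj₂ (proj₂ cleared-h))

      NM≢0 : ℕ.NonZero (N ℕ.* M)
      NM≢0 = ℕP.m*n≢0 N M {{proj₁ (proj₂ (proj₂ cleared-g))}} {{proj₁ (proj₂ (proj₂ cleared-h))}}

      GH≈NMP : G ⊗ H ≈ₚ + (N ℕ.* M) ⊙ P
      GH≈NMP = toℚ[x]-injective (G ⊗ H) (+ (N ℕ.* M) ⊙ P) λ n → begin
        coefℚ (toℚ[x] (G ⊗ H)) n
          ≡⟨ cong (λ u → coefℚ u n) (ℤ→ℚ.map-⊗ G H) ⟩
        coefℚ (toℚ[x] G ⊗ℚ toℚ[x] H) n
          ≡⟨ ℚ[x].⊗-congˡ {toℚ[x] G} {fromℤ (+ N) ⊙ℚ g} (toℚ[x] H) G≈Ng n ⟩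
        coefℚ ((fromℤ (+ N) ⊙ℚ g) ⊗ℚ toℚ[x] H) n
          ≡⟨ ℚ[x].⊗-congʳ (fromℤ (+ N) ⊙ℚ g) {toℚ[x] H} {fromℤ (+ M) ⊙ℚ h} H≈Mh n ⟩
        coefℚ ((fromℤ (+ N) ⊙ℚ g) ⊗ℚ (fromℤ (+ M) ⊙ℚ h)) n
          ≡⟨ ℚ[x].⊙-⊗ (fromℤ (+ N)) g (fromℤ (+ M) ⊙ℚ h) n ⟩
        coefℚ (fromℤ (+ N) ⊙ℚ (g ⊗ℚ (fromℤ (+ M) ⊙ℚ h))) n
          ≡⟨ ℚ[x].⊙-cong (fromℤ (+ N)) {g ⊗ℚ (fromℤ (+ M) ⊙ℚ h)} {fromℤ (+ M) ⊙ℚ (g ⊗ℚ h)} (ℚ[x].⊗-⊙ (fromℤ (+ M)) g h) n ⟩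
        coefℚ (fromℤ (+ N) ⊙ℚ (fromℤ (+ M) ⊙ℚ (g ⊗ℚ h))) n
          ≡⟨ ℚ[x].⊙-⊙ (fromℤ (+ N)) (fromℤ (+ M)) (g ⊗ℚ h) n ⟩
        coefℚ ((fromℤ (+ N) ℚ.* fromℤ (+ M)) ⊙ℚ (g ⊗ℚ h)) n
          ≡⟨ ℚ[x].⊙-cong (fromℤ (+ N) ℚ.* fromℤ (+ M)) {toℚ[x] P} {g ⊗ℚ h} P≈gh n ⟨
        coefℚ ((fromℤ (+ N) ℚ.* fromℤ (+ M)) ⊙ℚ toℚ[x] P) n
          ≡⟨ cong (λ c → coefℚ (c ⊙ℚ toℚ[x] P) n) (trans (cong fromℤ (ℤP.pos-* N M)) (fromℤ-* (+ N) (+ M))) ⟨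
        coefℚ (fromℤ (+ (N ℕ.* M)) ⊙ℚ toℚ[x] P) n
          ≡⟨ cong (λ u → coefℚ u n) (ℤ→ℚ.map-⊙ (+ (N ℕ.* M)) P) ⟨
        coefℚ (toℚ[x] (+ (N ℕ.* M) ⊙ P)) n ∎

      factors : PrimeFactorisation (N ℕ.* M)
      factors = factorise (N ℕ.* M) {{NM≢0}}

      normalised = normalise-sign {G} {P} P₀≡1 (gauss (PrimeFactorisation.factorsPrime factors) G H P
        (λ n → trans (GH≈NMP n) (cong (λ m → coef (+ m ⊙ P) n) (PrimeFactorisation.isFactorisation factors))))
      f = proj₁ normalised
      k = proj₁ (proj₂ normalised)
      c = proj₁ (proj₂ (proj₂ normalised))
      G≈cf = proj₁ (proj₂ (proj₂ (proj₂ normalised)))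
      fk≈P = proj₁ (proj₂ (proj₂ (proj₂ (proj₂ normalised))))
      f₀≡1 = proj₂ (proj₂ (proj₂ (proj₂ (proj₂ normalised))))

      c≢0 : c ≢ 0ℤ
      -- If c were 0, then G(0) H(0) would vanish, but it equals N M.
      c≢0 c≡0 = ℕP.m<n⇒n≢0 (ℕ.>-nonZero⁻¹ (N ℕ.* M) {{NM≢0}}) (sym (ℤP.+-injective (begin
        0ℤ                               ≡⟨⟩
        0ℤ ℤ.* coef f 0 ℤ.* coef H 0     ≡⟨ cong (λ u → u ℤ.* coef f 0 ℤ.* coef H 0) c≡0 ⟨
        c ℤ.* coef f 0 ℤ.* coef H 0      ≡⟨ cong (ℤ._* coef H 0) (trans (G≈cf 0) (coef-⊙ c f 0)) ⟨
        coef G 0 ℤ.* coef H 0            ≡⟨ coef-⊗-zero G H ⟨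
        coef (G ⊗ H) 0                   ≡⟨ GH≈NMP 0 ⟩
        coef (+ (N ℕ.* M) ⊙ P) 0         ≡⟨ coef-⊙ (+ (N ℕ.* M)) P 0 ⟩
        + (N ℕ.* M) ℤ.* coef P 0         ≡⟨ cong (λ u → + (N ℕ.* M) ℤ.* u) P₀≡1 ⟩
        + (N ℕ.* M) ℤ.* 1ℤ               ≡⟨ ℤP.*-identityʳ _ ⟩
        + (N ℕ.* M)                      ∎)))

      fromℤc≢0 : fromℤ c ≢ 0ℚ
      fromℤc≢0 eq = c≢0 (fromℤ-injective eq)
      1/c = (1/ fromℤ c) {{ℚ.≢-nonZero fromℤc≢0}}

      f≈ : toℚ[x] f ≈ℚ (1/c ℚ.* fromℤ (+ N)) ⊙ℚ g
      f≈ n = begin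
        coefℚ (toℚ[x] f) n
          ≡⟨ ⊙-inverse (toℚ[x] G) {toℚ[x] f} fromℤc≢0 (λ m → trans (ℤ→ℚ.map-≈ {G} {c ⊙ f} G≈cf m) (cong (λ u → coefℚ u m) (ℤ→ℚ.map-⊙ c f))) n ⟩
        coefℚ (1/c ⊙ℚ toℚ[x] G) n
          ≡⟨ ℚ[x].⊙-cong 1/c {toℚ[x] G} {fromℤ (+ N) ⊙ℚ g} G≈Ng n ⟩
        coefℚ (1/c ⊙ℚ (fromℤ (+ N) ⊙ℚ g)) n
          ≡⟨ ℚ[x].⊙-⊙ 1/c (fromℤ (+ N)) g n ⟩
        coefℚ ((1/c ℚ.* fromℤ (+ N)) ⊙ℚ g) n ∎

      scalar≢0 : 1/c ℚ.* fromℤ (+ N) ≢ 0ℚ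
      scalar≢0 eq = contradiction (fromℤ-injective {1ℤ} {0ℤ} (begin
        1ℚ                                      ≡⟨ cong fromℤ f₀≡1 ⟨
        fromℤ (coef f 0)                        ≡⟨ ℤ→ℚ.coef-map f 0 ⟨
        coefℚ (toℚ[x] f) 0                      ≡⟨ f≈ 0 ⟩
        coefℚ ((1/c ℚ.* fromℤ (+ N)) ⊙ℚ g) 0    ≡⟨ ℚ[x].coef-⊙ (1/c ℚ.* fromℤ (+ N)) g 0 ⟩
        1/c ℚ.* fromℤ (+ N) ℚ.* coefℚ g 0       ≡⟨ cong (ℚ._* coefℚ g 0) eq ⟩
        0ℚ ℚ.* coefℚ g 0                        ≡⟨ ℚP.*-zeroˡ (coefℚ g 0) ⟩
        0ℚ                                      ∎)) λ ()

    module _ {p s : ℕ} (p-prime : Prime p) (0<s : 0 ℕ.< s) (s<p : s ℕ.< p) {S : Poly}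
             (S≈P : S ≈ℚ toℚ[x] (numerator p s)) where

      -- The factor g is a nonzero multiple of an integral factor f with f(0) = 1. In degree at most
      -- 6 either f = 1, which makes g a unit, or f is the whole numerator, which makes S an
      -- associate of the irreducible g; the latter contradicts reducibility.
      irreducible-factor-degree : ReducibleP S → ∀ g → IrreducibleP g → g ∣P S → ∀ d → HasDegree g d → 7 ≤ d
      irreducible-factor-degree (_ , _ , S-reducible) g g-irreducible (h , S≈gh) d (_ , g≤d) =
        ℕP.≮⇒≥ λ d<7 → [ unit-case , associate-case ]′
          (numerator-factor p-prime 0<s s<p {f} {k} fk≈P f₀≡1 (f≤6 (ℕP.≤-pred d<7)))
        where
        P = numerator p s
        P₀≡1 : coef P 0 ≡ 1ℤ
        P₀≡1 = qRational-constant (numerator-qRational 0<s s<p)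

        integral = integral-factor {P} g h P₀≡1 λ n →
          trans (sym (S≈P n)) (trans (≈P⇒≈ₚ {S} {g *P h} S≈gh n) (cong (λ u → coefℚ u n) (*P≡⊗ g h)))
        f = proj₁ integral
        k = proj₁ (proj₂ integral)
        c = proj₁ (proj₂ (proj₂ integral))
        f≈cg = proj₁ (proj₂ (proj₂ (proj₂ integral)))
        fk≈P = proj₁ (proj₂ (proj₂ (proj₂ (proj₂ integral))))
        f₀≡1 = proj₁ (proj₂ (proj₂ (proj₂ (proj₂ (proj₂ integral)))))
        c≢0 = proj₂ (proj₂ (proj₂ (proj₂ (proj₂ (proj₂ integral)))))

        f≤6 : d ≤ 6 → Degree≤ f 6
        f≤6 d≤6 n 6<n = fromℤ-injective (begin
          fromℤ (coef f n)     ≡⟨ ℤ→ℚ.coef-map f n ⟨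
          coefℚ (toℚ[x] f) n   ≡⟨ f≈cg n ⟩
          coefℚ (c ⊙ℚ g) n     ≡⟨ ℚ[x].coef-⊙ c g n ⟩
          c ℚ.* coefℚ g n      ≡⟨ cong (λ u → c ℚ.* u) (trans (sym (coeff≡coef g n)) (g≤d n (ℕP.≤-<-trans d≤6 6<n))) ⟩
          c ℚ.* 0ℚ             ≡⟨ ℚP.*-zeroʳ c ⟩
          0ℚ                   ∎)
          where open ≡-Reasoning

        unit-case : ¬ f ≈ₚ 1ℤ ∷ []
        unit-case f≈1 = proj₁ (proj₂ g-irreducible) (c ∷ [] , ≈ₚ⇒≈P {g *P (c ∷ [])} {oneP} λ n → begin
          coefℚ (g *P (c ∷ [])) n   ≡⟨ cong (λ u → coefℚ u n) (*P≡⊗ g (c ∷ [])) ⟩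
          coefℚ (g ⊗ℚ (c ∷ [])) n   ≡⟨ ℚ[x].⊗-constant g c n ⟩
          coefℚ (c ⊙ℚ g) n          ≡⟨ f≈cg n ⟨
          coefℚ (toℚ[x] f) n        ≡⟨ ℤ→ℚ.map-≈ {f} {1ℤ ∷ []} f≈1 n ⟩
          coefℚ oneP n              ∎)
          where open ≡-Reasoning

        associate-case : ¬ f ≈ₚ P
        associate-case f≈P = S-reducible (irreducible-⊙ {c} S {g} c≢0
          (λ n → trans (S≈P n) (trans (sym (ℤ→ℚ.map-≈ {f} {P} f≈P n)) (f≈cg n))) g-irreducible)

open import Data.Nat using (_≤_)
open import Data.Integer using (∣_∣)

theorem7p10 : (p : ℕ) → Prime p → (a : ℤ) → Coprime ∣ a ∣ p →
    ReducibleP (Sq a p) →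
    ∀ (g : Poly) → IrreducibleP g → g ∣P Sq a p →
    ∀ (d : ℕ) → HasDegree g d → 7 ≤ d
theorem7p10 0             p-prime a coprime = contradiction p-prime ¬prime[0]
theorem7p10 1             p-prime a coprime = contradiction p-prime ¬prime[1]
theorem7p10 (suc (suc n)) p-prime a coprime =
  let s , 0<s , s<p , Sq≡ = Sq-numerator (suc n) (ℕ.s≤s ℕ.z≤n) a p∤a
  in irreducible-factor-degree p-prime 0<s s<p {Sq a (suc (suc n))}
       (subst (ℚ[x]._≈ₚ toℚ[x] (numerator (suc (suc n)) s)) (sym Sq≡)
         (proj₁ (RS-correct (suc n) (suc (suc n)) s (ℕ.s≤s ℕ.z≤n))))
  where
  p∤a : ¬ (+ suc (suc n) ∣ a)
  p∤a p∣a = contradiction (coprime (ℤ∣.∣⇒∣ᵤ p∣a , ℕ∣.∣-refl)) λ ()
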